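{- Let $\hat V$ be an $\omega$-nonstandard model of $ZFC^-$ and let $\lambda<\mathfrak{p}_{\hat V}$ be a cardinal. Let $p(x)=\{\varphi_\alpha(x,a_\alpha):\alpha<\lambda\}$ be a partial type over $\hat V$ (i.e. each $\varphi_\alpha$ is a formula of the language of set theory, $a_\alpha\in\hat V$, and every finite subset of $p(x)$ is realized in $\hat V$). Suppose there is $\hat X\in\hat V$ which is finite in the sense of $\hat V$ such that $\varphi_0(x,a_0)$ is the formula $x\in\hat X$. Then $p(x)$ is realized in $\hat V$.
   Context: $ZFC^-$ denotes $ZFC$ without the powerset axiom, with replacement strengthened to collection and choice strengthened to the well-ordering principle. For a model $\hat V \models ZFC^-$, write $\hat\omega$ for $\omega^{\hat V}$ and $\hat<$ for its order. $\hat V$ is $\omega$-nonstandard if $\hat\omega \neq \omega$. For infinite regular cardinals $\kappa,\theta$, a $(\kappa,\theta)$-cut in a linear order $(L,<)$ is a pair of sequences $(a_\alpha:\alpha<\kappa)$ increasing and $(b_\beta:\beta<\theta)$ decreasing with $a_\alpha<b_\beta$ for all $\alpha,\beta$, such that no $c\in L$ satisfies $a_\alpha<c<b_\beta$ for all $\alpha,\beta$. $\mathfrak{p}_{\hat V}$ is the least value of $\kappa+\theta$ over all pairs $(\kappa,\theta)$ such that $(\hat\omega,\hat<)$ admits a $(\kappa,\theta)$-cut. -}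

module Defs where

open import Level using (Level) renaming (suc to lsuc)
open import Data.Nat using (ℕ; zero; suc)
open import Data.Fin using (Fin)
open import Data.Vec using (Vec; []; _∷_; lookup)
open import Data.List using (List)
open import Data.List.Relation.Unary.All using (All)
open import Data.Product using (∃-syntax; Σ-syntax; ∃!; _×_; proj₁)
open import Data.Sum using (_⊎_)
open import Data.Empty.Polymorphic using (⊥)
open import Function using (_on_)
open import Function.Bundles using (_↣_; _↔_; _⇔_)
open import Function.Definitions using (Injective)
open import Induction.WellFounded using (WellFounded)
open import Relation.Nullary using (¬_)
open import Relation.Binary.Core using (Rel)
open import Relation.Binary.Structures using (IsStrictTotalOrder)
open import Relation.Binary.PropositionalEquality using (_≡_)

------------------------------------------------------------------------
-- First-order language of set theory

infix  8 _∈ᶠ_ _≐ᶠ_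
infixr 7 _∧ᶠ_
infixr 6 _∨ᶠ_
infixr 5 _⇒ᶠ_

-- Formula n: formulas with free variables among n de Bruijn indices.
data Formula : ℕ → Set where
  _∈ᶠ_ _≐ᶠ_      : ∀ {n} → Fin n → Fin n → Formula n
  ⊥ᶠ             : ∀ {n} → Formula n
  _∧ᶠ_ _∨ᶠ_ _⇒ᶠ_ : ∀ {n} → Formula n → Formula n → Formula n
  ∀ᶠ ∃ᶠ          : ∀ {n} → Formula (suc n) → Formula n

¬ᶠ_ : ∀ {n} → Formula n → Formula n
¬ᶠ φ = φ ⇒ᶠ ⊥ᶠ

-- The equality symbol is interpreted as propositional equality.
record Structure (ℓ : Level) : Set (lsuc ℓ) where
  infix 4 _∈_
  field
    Carrier : Set ℓ
    _∈_     : Rel Carrier ℓ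

module _ {ℓ : Level} (𝕍 : Structure ℓ) where
  open Structure 𝕍 renaming (Carrier to V)

  Sat : ∀ {n} → Formula n → Vec V n → Set ℓ
  Sat (i ∈ᶠ j) ρ = lookup ρ i ∈ lookup ρ j
  Sat (i ≐ᶠ j) ρ = lookup ρ i ≡ lookup ρ j
  Sat ⊥ᶠ       ρ = ⊥
  Sat (φ ∧ᶠ ψ) ρ = Sat φ ρ × Sat ψ ρ
  Sat (φ ∨ᶠ ψ) ρ = Sat φ ρ ⊎ Sat ψ ρ
  Sat (φ ⇒ᶠ ψ) ρ = Sat φ ρ → Sat ψ ρ
  Sat (∀ᶠ φ)   ρ = ∀ x → Sat φ (x ∷ ρ)
  Sat (∃ᶠ φ)   ρ = ∃[ x ] Sat φ (x ∷ ρ)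

  ----------------------------------------------------------------------
  -- Set-theoretic notions evaluated in 𝕍: each is the Tarskian
  -- satisfaction condition, written out, of the usual first-order formula.

  IsEmpty : V → Set ℓ
  IsEmpty x = ∀ y → ¬ (y ∈ x)

  _⊆_ : Rel V ℓ
  x ⊆ y = ∀ z → z ∈ x → z ∈ y

  IsPair : V → V → V → Set ℓ
  IsPair p x y = ∀ z → z ∈ p ⇔ (z ≡ x ⊎ z ≡ y)

  -- p = (x , y) = {{x} , {x , y}}
  IsOrderedPair : V → V → V → Set ℓ
  IsOrderedPair p x y =
    ∃[ s ] ∃[ d ] (IsPair s x x × IsPair d x y × IsPair p s d)

  -- (x , y) ∈ r
  Related : V → V → V → Set ℓ
  Related r x y = ∃[ p ] (IsOrderedPair p x y × p ∈ r)

  -- s = x ∪ {x}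
  IsSuccessor : V → V → Set ℓ
  IsSuccessor s x = ∀ z → z ∈ s ⇔ (z ∈ x ⊎ z ≡ x)

  IsInductive : V → Set ℓ
  IsInductive w =
    (∃[ e ] (IsEmpty e × e ∈ w)) ×
    (∀ x → x ∈ w → ∃[ s ] (IsSuccessor s x × s ∈ w))

  -- w = ω
  IsOmega : V → Set ℓ
  IsOmega w = IsInductive w × (∀ u → IsInductive u → w ⊆ u)

  record IsBijection (f x y : V) : Set ℓ where
    field
      pairs      : ∀ p → p ∈ f →
                   ∃[ u ] ∃[ v ] (u ∈ x × v ∈ y × IsOrderedPair p u v)
      functional : ∀ u → u ∈ x → ∃! _≡_ (λ v → v ∈ y × Related f u v)
      bijective  : ∀ v → v ∈ y → ∃! _≡_ (λ u → u ∈ x × Related f u v)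

  IsFinite : V → Set ℓ
  IsFinite X =
    ∃[ ω̂ ] (IsOmega ω̂ × ∃[ n ] (n ∈ ω̂ × ∃[ f ] IsBijection f n X))

  record WellOrders (r X : V) : Set ℓ where
    field
      irreflexive : ∀ x → x ∈ X → ¬ Related r x x
      transitive  : ∀ x y z → x ∈ X → y ∈ X → z ∈ X →
                    Related r x y → Related r y z → Related r x z
      total       : ∀ x y → x ∈ X → y ∈ X →
                    Related r x y ⊎ x ≡ y ⊎ Related r y x
      least       : ∀ u → u ⊆ X → (∃[ x ] x ∈ u) →
                    ∃[ m ] (m ∈ u × (∀ y → y ∈ u → m ≡ y ⊎ Related r m y))

  -- 𝕍 ⊨ ZFC⁻.
  record IsModelOfZFC⁻ : Set ℓ where
    field
      extensionality : ∀ x y → (∀ z → z ∈ x ⇔ z ∈ y) → x ≡ y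
      foundation     : ∀ x → (∃[ y ] y ∈ x) →
                       ∃[ y ] (y ∈ x × (∀ z → z ∈ y → ¬ (z ∈ x)))
      pairing        : ∀ x y → ∃[ p ] IsPair p x y
      union          : ∀ x → ∃[ u ] (∀ z → z ∈ u ⇔ (∃[ y ] (y ∈ x × z ∈ y)))
      infinity       : ∃[ w ] IsInductive w
      separation     : ∀ {n} (φ : Formula (suc n)) (ρ : Vec V n) (x : V) →
                       ∃[ y ] (∀ z → z ∈ y ⇔ (z ∈ x × Sat φ (z ∷ ρ)))
      -- Variable 0 of φ is the value and variable 1 the argument.
      collection     : ∀ {n} (φ : Formula (suc (suc n))) (ρ : Vec V n) (x : V) →
                       (∀ u → u ∈ x → ∃[ v ] Sat φ (v ∷ u ∷ ρ)) →
                       ∃[ y ] (∀ u → u ∈ x → ∃[ v ] (v ∈ y × Sat φ (v ∷ u ∷ ρ)))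
      wellOrdering   : ∀ X → ∃[ r ] WellOrders r X

  -- c is the interpretation in 𝕍 of the external natural number n.
  IsNumeral : ℕ → V → Set ℓ
  IsNumeral zero    c = IsEmpty c
  IsNumeral (suc n) c = ∃[ d ] (IsNumeral n d × IsSuccessor c d)

  -- ω̂ ≠ ω, where the external ω is identified with the numerals of 𝕍.
  IsNonstandardOmega : V → Set ℓ
  IsNonstandardOmega ω̂ = ¬ (∀ c → c ∈ ω̂ → ∃[ n ] IsNumeral n c)

  -- The linear order (ω̂ , <̂); the order of ω̂ is membership.
  ElementsOf : V → Set ℓ
  ElementsOf ω̂ = Σ[ c ∈ V ] (c ∈ ω̂)

  _<̂_ : ∀ {ω̂} → Rel (ElementsOf ω̂) ℓ
  _<̂_ = _∈_ on proj₁

------------------------------------------------------------------------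
-- External cardinals

-- A cardinal is an initial ordinal, presented as a well-ordered type that
-- does not inject into any of its proper initial segments.
record Cardinal (ℓ : Level) : Set (lsuc ℓ) where
  infix 4 _<_
  field
    Carrier            : Set ℓ
    _<_                : Rel Carrier ℓ
    isStrictTotalOrder : IsStrictTotalOrder _≡_ _<_
    wellFounded        : WellFounded _<_
    initial            : ∀ β (f : Carrier → Carrier) →
                         Injective _≡_ _≡_ f → ¬ (∀ α → f α < β)

module _ {ℓ : Level} where
  open Cardinal using () renaming (Carrier to ∣_∣)

  -- No map from a proper initial segment {α | α < β} is cofinal. Quantifying
  -- over total maps, of which only the values below β matter, avoids maps
  -- depending on the proof of α < β.
  record IsInfiniteRegular (κ : Cardinal ℓ) : Set ℓ where
    open Cardinal κ
    field
      infinite : ℕ ↣ Carrier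
      regular  : ∀ β (f : Carrier → Carrier) →
                 ∃[ γ ] (∀ α → α < β → f α < γ)

  infix 4 _<ᶜ_
  _<ᶜ_ : Rel (Cardinal ℓ) ℓ
  κ <ᶜ μ = (∣ κ ∣ ↣ ∣ μ ∣) × ¬ (∣ μ ∣ ↣ ∣ κ ∣)

  record Cut (κ θ : Cardinal ℓ) {L : Set ℓ} (_≺_ : Rel L ℓ) : Set ℓ where
    open Cardinal κ using () renaming (_<_ to _<κ_)
    open Cardinal θ using () renaming (_<_ to _<θ_)
    field
      a          : ∣ κ ∣ → L
      b          : ∣ θ ∣ → L
      increasing : ∀ α α′ → α <κ α′ → a α ≺ a α′
      decreasing : ∀ β β′ → β <θ β′ → b β′ ≺ b β
      below      : ∀ α β → a α ≺ b β
      unfilled   : ∀ c → ¬ (∀ α β → a α ≺ c × c ≺ b β)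

  -- 𝔭 is the least value of κ + θ over the infinite regular κ, θ such that
  -- (L , ≺) admits a (κ , θ)-cut; κ + θ is the cardinality of ∣ κ ∣ ⊎ ∣ θ ∣.
  record IsLeastCut {L : Set ℓ} (_≺_ : Rel L ℓ) (𝔭 : Cardinal ℓ) : Set (lsuc ℓ) where
    field
      attained : Σ[ κ ∈ Cardinal ℓ ] Σ[ θ ∈ Cardinal ℓ ]
                 (IsInfiniteRegular κ × IsInfiniteRegular θ ×
                  Cut κ θ _≺_ × (∣ 𝔭 ∣ ↔ (∣ κ ∣ ⊎ ∣ θ ∣)))
      minimal  : (κ θ : Cardinal ℓ) → IsInfiniteRegular κ → IsInfiniteRegular θ →
                 Cut κ θ _≺_ → ∣ 𝔭 ∣ ↣ (∣ κ ∣ ⊎ ∣ θ ∣)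

  Is𝔭 : (𝕍 : Structure ℓ) → Structure.Carrier 𝕍 → Cardinal ℓ → Set (lsuc ℓ)
  Is𝔭 𝕍 ω̂ 𝔭 = IsLeastCut (_<̂_ 𝕍 {ω̂}) 𝔭

  IsZero : (κ : Cardinal ℓ) → ∣ κ ∣ → Set ℓ
  IsZero κ o = ∀ α → ¬ (Cardinal._<_ κ α o)

------------------------------------------------------------------------
-- Types over 𝕍

module _ {ℓ : Level} (𝕍 : Structure ℓ) {I : Set ℓ} where
  open Structure 𝕍 renaming (Carrier to V)

  -- In φ i, variable 0 is x and variable 1 is the parameter a i.
  Realizes : (φ : I → Formula 2) (a : I → V) → V → I → Set ℓ
  Realizes φ a c i = Sat 𝕍 (φ i) (c ∷ a i ∷ [])

  IsPartialType : (φ : I → Formula 2) (a : I → V) → Set ℓ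
  IsPartialType φ a = (s : List I) → ∃[ c ] All (Realizes φ a c) s

  IsRealized : (φ : I → Formula 2) (a : I → V) → Set ℓ
  IsRealized φ a = ∃[ c ] (∀ i → Realizes φ a c i)

{-# OPTIONS --safe #-}
module Submission where

-- Let d ∈ ω̂ be the size of X̂. The type becomes a family of λ many internal
-- subsets A_α of d with the finite intersection property. By induction on the
-- length of an initial segment, all A_γ with γ ≤ α meet in some v_α, so it
-- remains to pass from proper initial segments to a segment P without maximum.
--
-- Numbers c ∈ ω̂ are branches of a d-ary tree: the node of c at height j is
-- ⌊c / dʲ⌋ and the digit there is ⌊c / dʲ⌋ mod d. By recursion choose
-- (c_α , j_α) with j_α nonstandard and decreasing, c_α passing through the node
-- of c_γ at height j_γ for γ < α, and with all digits of c_α from j_α up to j_γ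
-- in A_γ; the digit at j_α is v_α. At a limit stage, the branches through a node
-- form an interval and the intervals are nested, so, as there are no cuts of
-- size ≤ λ in ω̂, some c passes through all the nodes. For each γ the heights
-- above which the digits of c up to j_γ lie in A_γ are bounded below by a number
-- that lies below every j_δ, and filling this second gap yields a height j that
-- works for all γ. After running through P, the digit of c at j lies in all A_γ.

open import Defs
open import Axiom.ExcludedMiddle using (ExcludedMiddle)
open import Axiom.Extensionality.Propositional using (Extensionality; implicit-extensionality)
open import Data.Bool using (T)
open import Data.Bool.Properties using (T-irrelevant)
open import Data.Empty using (⊥-elim)
import Data.Empty.Polymorphic as Poly
open import Data.Fin using (Fin; zero; suc)
open import Data.List using (List; []; _∷_)
open import Data.List.Membership.Propositional using () renaming (_∈_ to _∈ₗ_; _∉_ to _∉ₗ_)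
open import Data.List.Relation.Unary.All as All using (All)
open import Data.List.Relation.Unary.Any using (here; there)
import Data.Nat as ℕ
import Data.Nat.Properties as ℕₚ
open ℕ using (ℕ; zero; suc)
open import Data.Product using (∃; ∃-syntax; Σ-syntax; _×_; _,_; proj₁; proj₂)
open import Data.Sum as Sum using (_⊎_; inj₁; inj₂)
open import Data.Sum.Function.Propositional using (_⊎-↣_)
open import Data.Unit.Polymorphic using (⊤; tt)
open import Data.Vec using (Vec; []; _∷_; lookup)
open import Function using (_∘_; case_of_; flip; id)
open import Function.Bundles using (_⇔_; mk⇔; Equivalence; _↣_; mk↣)
open import Function.Construct.Composition using (_↣-∘_)
open import Function.Definitions using (Injective)
open import Induction.WellFounded using (WellFounded; WfRec; module FixPoint) renaming (module All to WF)
open import Level using (Level; _⊔_)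
import Relation.Binary.Construct.On as On
open import Relation.Binary.Core using (Rel)
open import Relation.Binary.Definitions using (tri<; tri≈; tri>; Trichotomous)
open import Relation.Binary.PropositionalEquality
  using (_≡_; _≢_; refl; sym; trans; cong; cong₂; subst; subst₂; isEquivalence; resp₂)
open import Relation.Binary.Structures using (IsStrictTotalOrder)
open import Relation.Nullary using (¬_; yes; no)
open import Relation.Nullary.Decidable using (toWitness; fromWitness; isYes)

-- Classical logic and well-orders

module Classical (em : ∀ {a} → ExcludedMiddle a) where

  ¬∀⇒∃¬ : ∀ {a p} {A : Set a} {P : A → Set p} → ¬ (∀ x → P x) → ∃[ x ] ¬ P x
  ¬∀⇒∃¬ {P = P} ¬∀ with em {P = ∃[ x ] ¬ P x}
  ... | yes ∃¬ = ∃¬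
  ... | no ¬∃¬ = ⊥-elim (¬∀ λ x → case em of λ where
    (yes px) → px
    (no ¬px) → ⊥-elim (¬∃¬ (x , ¬px)))

  -- `em` returns a witness of `∃ P` along with its decision, which makes it a choice operator; `d`
  -- is the default when there is no witness.
  choose : ∀ {a p} {A : Set a} → A → (A → Set p) → A
  choose d P with em {P = ∃ P}
  ... | yes (x , _) = x
  ... | no _        = d

  choose-correct : ∀ {a p} {A : Set a} (d : A) (P : A → Set p) → ∃ P → P (choose d P)
  choose-correct d P ∃p with em {P = ∃ P}
  ... | yes (_ , px) = px
  ... | no ∄p        = ⊥-elim (∄p ∃p)

  preimage : ∀ {a b} {A : Set a} {B : Set b} → (A → B) → A → B → A
  preimage f d b = choose d (λ a → f a ≡ b)

  preimage-correct : ∀ {a b} {A : Set a} {B : Set b} (f : A → B) (d a : A) →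
                     f (preimage f d (f a)) ≡ f a
  preimage-correct f d a = choose-correct d (λ a′ → f a′ ≡ f a) (a , refl)

  abstract
    -- Well-founded recursion with `choose`, followed by a well-founded induction showing that each
    -- chosen value is good. Function extensionality gives the unfolding equation of the recursion.
    dependentChoice :
      (∀ {a b} → Extensionality a b) →
      ∀ {w r s g q} {W : Set w} {_<_ : Rel W r} → WellFounded _<_ →
      {S : Set s} (d : S) (G : W → S → Set g) (R : W → S → W → S → Set q) →
      (∀ α (f : W → S) →
        (∀ γ → γ < α → G γ (f γ)) →
        (∀ γ δ → γ < δ → δ < α → R γ (f γ) δ (f δ)) →
        ∃[ s ] (G α s × (∀ γ → γ < α → R γ (f γ) α s))) →
      Σ[ f ∈ (W → S) ]
        ((∀ α → G α (f α)) × (∀ γ δ → γ < δ → R γ (f γ) δ (f δ)))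
    dependentChoice ext {w} {r} {s} {g} {q} {W} {_<_} wf {S} d G R extend =
      f , (λ α → proj₁ (good α)) , λ γ δ γ<δ → proj₂ (good δ) γ γ<δ
      where
      Good : ∀ α → WfRec _<_ (λ _ → S) α → S → Set (w ⊔ r ⊔ g ⊔ q)
      Good α rec s = G α s × (∀ γ (γ<α : γ < α) → R γ (rec γ<α) α s)

      step : ∀ α → WfRec _<_ (λ _ → S) α → S
      step α rec = choose d (Good α rec)

      open FixPoint wf (λ _ → S) step
        (λ α eq → cong (step α) (implicit-extensionality ext (ext λ γ<α → eq γ<α)))
        using (unfold-wfRec)

      f : W → S
      f = WF.wfRec wf s (λ _ → S) step

      good : ∀ α → Good α (λ {γ} _ → f γ) (f α)
      good = WF.wfRec wf _ _ λ α ih →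
        subst (Good α (λ {γ} _ → f γ)) (sym unfold-wfRec)
          (choose-correct d (Good α _) (extend α f (λ γ γ<α → proj₁ (ih γ<α))
                                   (λ γ δ γ<δ δ<α → proj₂ (ih δ<α) γ γ<δ)))

  module FreshSequence {a} {A : Set a} (x₀ : A)
                       (fresh : (s : List A) → ∃[ x ] x ∉ₗ s) where

    -- The list records all earlier terms, so that the next one can avoid them.
    state : ℕ → A × List A
    state zero    = x₀ , []
    state (suc k) = let (x , s) = state k in proj₁ (fresh (x ∷ s)) , x ∷ s

    seq : ℕ → A
    seq = proj₁ ∘ state

    seq-fresh : ∀ k → seq k ∉ₗ proj₂ (state k)
    seq-fresh zero    ()
    seq-fresh (suc k) = proj₂ (fresh _)

    seq-seen : ∀ {j k} → j ℕ.<′ k → seq j ∈ₗ proj₂ (state k)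
    seq-seen (ℕ.<′-base)     = here refl
    seq-seen (ℕ.<′-step j<k) = there (seq-seen j<k)

    seq-injective : Injective _≡_ _≡_ seq
    seq-injective {j} {k} eq with ℕₚ.<-cmp j k
    ... | tri< j<k _ _ = ⊥-elim (seq-fresh k (subst (_∈ₗ _) eq (seq-seen (ℕₚ.<⇒<′ j<k))))
    ... | tri≈ _ j≡k _ = j≡k
    ... | tri> _ _ k<j = ⊥-elim (seq-fresh j (subst (_∈ₗ _) (sym eq) (seq-seen (ℕₚ.<⇒<′ k<j))))

  -- Separates finite from infinite index types: if a list exhausts the indices, finite
  -- satisfiability already realizes the whole type.
  enumerated-or-infinite : ∀ {a} (A : Set a) →
    (Σ[ s ∈ List A ] (∀ x → x ∈ₗ s)) ⊎ ((s : List A) → ∃[ x ] x ∉ₗ s)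
  enumerated-or-infinite A with em {P = Σ[ s ∈ List A ] (∀ x → x ∈ₗ s)}
  ... | yes enum  = inj₁ enum
  ... | no  ¬enum = inj₂ λ s → ¬∀⇒∃¬ λ all → ¬enum (s , all)

  -- Initial ordinals: successors, doubling, cofinality

  module WellOrder {ℓ : Level} (Λ : Cardinal ℓ) where
    open Cardinal Λ renaming (Carrier to I) public
    open IsStrictTotalOrder isStrictTotalOrder public
      using (compare) renaming (trans to <-trans)

    <-irrefl : ∀ {x} → ¬ (x < x)
    <-irrefl = IsStrictTotalOrder.irrefl isStrictTotalOrder refl

    <-induction : ∀ {p} (P : I → Set p) → (∀ x → (∀ {y} → y < x → P y) → P x) → ∀ x → P x
    <-induction P = WF.wfRec wellFounded _ P

    least : ∀ {p} (P : I → Set p) → ∃ P → ∃[ m ] (P m × (∀ x → P x → ¬ (x < m)))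
    least P (x , px) = <-induction (λ x → P x → _) go x px
      where
      go : ∀ x → (∀ {y} → y < x → P y → ∃[ m ] (P m × (∀ x → P x → ¬ (x < m)))) →
           P x → ∃[ m ] (P m × (∀ x → P x → ¬ (x < m)))
      go x ih px with em {P = ∃[ y ] (y < x × P y)}
      ... | yes (y , y<x , py) = ih y<x py
      ... | no ∄               = x , px , λ y py y<x → ∄ (y , y<x , py)

    module Infinite (fresh : (s : List I) → ∃[ x ] x ∉ₗ s) where

      -- A largest element m could be removed injectively by a Hilbert
      -- hotel starting at m, against initiality.
      unbounded : ∀ m → ∃[ x ] m < x
      unbounded m with em {P = ∃[ x ] m < x}
      ... | yes above = above
      ... | no ∄above = ⊥-elim (initial m shift shift-injective shift<m)
        where
        open FreshSequence m fresh

        shift : I → I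
        shift x with em {P = ∃[ k ] seq k ≡ x}
        ... | yes (k , _) = seq (suc k)
        ... | no _        = x

        shift-injective : Injective _≡_ _≡_ shift
        shift-injective {x} {y} eq
          with em {P = ∃[ k ] seq k ≡ x} | em {P = ∃[ k ] seq k ≡ y}
        ... | yes (j , refl) | yes (k , refl) = cong seq (ℕₚ.suc-injective (seq-injective {suc j} {suc k} eq))
        ... | yes (j , _)    | no ∄k          = ⊥-elim (∄k (suc j , eq))
        ... | no ∄j          | yes (k , _)    = ⊥-elim (∄j (suc k , sym eq))
        ... | no _           | no _           = eq

        shift≢m : ∀ x → shift x ≢ m
        shift≢m x eq with em {P = ∃[ k ] seq k ≡ x}
        ... | yes (k , _) = case seq-injective {suc k} {0} eq of λ ()
        ... | no ∄k       = ∄k (0 , sym eq)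

        shift<m : ∀ x → shift x < m
        shift<m x with compare (shift x) m
        ... | tri< lt _ _ = lt
        ... | tri≈ _ eq _ = ⊥-elim (shift≢m x eq)
        ... | tri> _ _ gt = ⊥-elim (∄above (shift x , gt))

      private
        next : ∀ x → ∃[ m ] (x < m × (∀ y → x < y → ¬ (y < m)))
        next x = least (x <_) (unbounded x)

      succ : I → I
      succ = proj₁ ∘ next

      x<succ : ∀ x → x < succ x
      x<succ x = proj₁ (proj₂ (next x))

      succ-least : ∀ {x y} → x < y → ¬ (y < succ x)
      succ-least {x} = proj₂ (proj₂ (next x)) _

      succ-injective : ∀ {x y} → succ x ≡ succ y → x ≡ y
      succ-injective {x} {y} eq with compare x y
      ... | tri< x<y _ _ = ⊥-elim (succ-least x<y (subst (y <_) (sym eq) (x<succ y)))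
      ... | tri≈ _ x≡y _ = x≡y
      ... | tri> _ _ y<x = ⊥-elim (succ-least y<x (subst (x <_) eq (x<succ x)))

      -- The least element counts as a limit.
      IsLimit : I → Set ℓ
      IsLimit l = ∀ x → succ x ≢ l

      _+ⁿ_ : I → ℕ → I
      x +ⁿ zero  = x
      x +ⁿ suc n = succ (x +ⁿ n)

      +ⁿ-injective : ∀ {l l′} → IsLimit l → IsLimit l′ → ∀ m n →
                     l +ⁿ m ≡ l′ +ⁿ n → l ≡ l′ × m ≡ n
      +ⁿ-injective lim lim′ zero    zero    eq = eq , refl
      +ⁿ-injective lim lim′ zero    (suc n) eq = ⊥-elim (lim _ (sym eq))
      +ⁿ-injective lim lim′ (suc m) zero    eq = ⊥-elim (lim′ _ eq)
      +ⁿ-injective lim lim′ (suc m) (suc n) eq =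
        let (p , q) = +ⁿ-injective lim lim′ m n (succ-injective eq) in p , cong suc q

      decompose : ∀ x → ∃[ l ] ∃[ n ] (IsLimit l × l +ⁿ n ≡ x)
      decompose = <-induction _ go
        where
        go : ∀ x → (∀ {y} → y < x → ∃[ l ] ∃[ n ] (IsLimit l × l +ⁿ n ≡ y)) →
             ∃[ l ] ∃[ n ] (IsLimit l × l +ⁿ n ≡ x)
        go x ih with em {P = ∃[ y ] succ y ≡ x}
        ... | no ∄y           = x , 0 , (λ y eq → ∄y (y , eq)) , refl
        ... | yes (y , refl) with ih (x<succ y)
        ...   | l , n , lim , eq = l , suc n , lim , cong succ eq

      -- l + n ↦ l + 2n and l + n ↦ l + 2n + 1 on the two copies (l a limit).
      double : I ⊎ I → I
      double (inj₁ x) = let (l , n , _) = decompose x in l +ⁿ (2 ℕ.* n)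
      double (inj₂ x) = let (l , n , _) = decompose x in l +ⁿ suc (2 ℕ.* n)

      double-injective : Injective _≡_ _≡_ double
      double-injective {inj₁ x} {inj₁ y} eq with decompose x | decompose y
      ... | l , m , lim , refl | l′ , n , lim′ , refl with +ⁿ-injective lim lim′ (2 ℕ.* m) (2 ℕ.* n) eq
      ...   | refl , q with ℕₚ.*-cancelˡ-≡ m n 2 q
      ...     | refl = refl
      double-injective {inj₁ x} {inj₂ y} eq with decompose x | decompose y
      ... | l , m , lim , refl | l′ , n , lim′ , refl =
        ⊥-elim (ℕₚ.even≢odd m n (proj₂ (+ⁿ-injective lim lim′ (2 ℕ.* m) (suc (2 ℕ.* n)) eq)))
      double-injective {inj₂ x} {inj₁ y} eq with decompose x | decompose y
      ... | l , m , lim , refl | l′ , n , lim′ , refl =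
        ⊥-elim (ℕₚ.even≢odd n m (sym (proj₂ (+ⁿ-injective lim lim′ (suc (2 ℕ.* m)) (2 ℕ.* n) eq))))
      double-injective {inj₂ x} {inj₂ y} eq with decompose x | decompose y
      ... | l , m , lim , refl | l′ , n , lim′ , refl
        with +ⁿ-injective lim lim′ (suc (2 ℕ.* m)) (suc (2 ℕ.* n)) eq
      ...   | refl , q with ℕₚ.*-cancelˡ-≡ m n 2 (ℕₚ.suc-injective q)
      ...     | refl = refl

    -- κ is the least length of an initial segment of I on which some map is
    -- cofinal in a; minimality makes it initial and regular.
    module Cofinality
      (ext : ∀ {a b} → Extensionality a b)
      {L : Set ℓ} (_≺_ : Rel L ℓ)
      (≺-irrefl : ∀ {x} → ¬ (x ≺ x))
      (≺-trans : ∀ {x y z} → x ≺ y → y ≺ z → x ≺ z)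
      (≺-cotrans : ∀ {x z} y → x ≺ z → x ≺ y ⊎ y ≺ z)
      (i₀ : I) (a : I → L) (noMax : ∀ i → ∃[ j ] (a i ≺ a j))
      where

      _≼_ : Rel L ℓ
      x ≼ y = ¬ (y ≺ x)

      ≼-≺-trans : ∀ {x y z} → x ≼ y → y ≺ z → x ≺ z
      ≼-≺-trans {x} x≼y y≺z with ≺-cotrans x y≺z
      ... | inj₁ y≺x = ⊥-elim (x≼y y≺x)
      ... | inj₂ x≺z = x≺z

      CofinalBelow : I → Set ℓ
      CofinalBelow β = Σ[ f ∈ (I → I) ] (∀ i → ∃[ α ] (α < β × a i ≼ a (f α)))

      -- The cofinality of a, as an initial segment of I.
      S : I → Set ℓ
      S α = ∀ β → CofinalBelow β → α < β

      S⇒¬cofinal : ∀ {α} → S α → ¬ CofinalBelow α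
      S⇒¬cofinal Sα cof = <-irrefl (Sα _ cof)

      S-cofinal : Σ[ f ∈ (I → I) ] (∀ i → ∃[ α ] (S α × a i ≼ a (f α)))
      S-cofinal with em {P = ∃ CofinalBelow}
      -- No proper initial segment carries a cofinal map, so `S` is all of `I` and the identity is
      -- cofinal.
      ... | no ∄β = (λ i → i) , λ i → i , (λ β cof → ⊥-elim (∄β (β , cof))) , ≺-irrefl
      ... | yes ∃β with least CofinalBelow ∃β
      ...   | β , (f , cof) , min = f , λ i → case cof i of λ where
        (α , α<β , le) → α , (λ γ cofγ → case compare β γ of λ where
          (tri< β<γ _ _)  → <-trans α<β β<γ
          (tri≈ _ refl _) → α<β
          (tri> _ _ γ<β)  → ⊥-elim (min γ cofγ γ<β)) , le

      f : I → I
      f = proj₁ S-cofinal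

      upper : ∀ i j → ∃[ k ] (a i ≺ a k × a j ≺ a k)
      upper i j with em {P = a i ≺ a j}
      ... | yes i≺j = let (k , j≺k) = noMax j in k , ≺-trans i≺j j≺k , j≺k
      ... | no  i⊀j = let (k , i≺k) = noMax i in k , i≺k , ≼-≺-trans i⊀j i≺k

      abstract
        -- Makes the cofinal map strictly increasing on `S` while dominating `f`. For `α` in `S` the
        -- earlier values are not cofinal, so some `a i` lies above all of them, and the next value
        -- is taken above both `a i` and `a (f α)`.
        thinning : Σ[ s ∈ (I → I) ]
          ((∀ α → S α → a (f α) ≺ a (s α)) ×
           (∀ γ δ → γ < δ → S δ → a (s γ) ≺ a (s δ)))
        thinning = dependentChoice ext wellFounded i₀
          (λ α s → S α → a (f α) ≺ a s) (λ γ s δ t → S δ → a s ≺ a t) extend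
          where
          extend : ∀ α (s : I → I) →
                   (∀ γ → γ < α → S γ → a (f γ) ≺ a (s γ)) →
                   (∀ γ δ → γ < δ → δ < α → S δ → a (s γ) ≺ a (s δ)) →
                   ∃[ t ] ((S α → a (f α) ≺ a t) × (∀ γ → γ < α → S α → a (s γ) ≺ a t))
          extend α s _ _ with em {P = S α}
          ... | no ¬Sα = i₀ , (λ Sα → ⊥-elim (¬Sα Sα)) , λ _ _ Sα → ⊥-elim (¬Sα Sα)
          ... | yes Sα with ¬∀⇒∃¬ (λ cof → S⇒¬cofinal Sα (s , cof))
          ...   | i , bounds with upper i (f α)
          ...     | k , i≺k , fα≺k = k , (λ _ → fα≺k) , λ γ γ<α _ →
            case em of λ where
              (yes sγ≺k) → sγ≺k
              (no  sγ⊀k) → ⊥-elim (bounds (γ , γ<α , λ sγ≺i → sγ⊀k (≺-trans sγ≺i i≺k)))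

      s : I → I
      s = proj₁ thinning

      s-cofinal : ∀ i → ∃[ α ] (S α × a i ≺ a (s α))
      s-cofinal i =
        let (α , Sα , le) = proj₂ S-cofinal i
        in  α , Sα , ≼-≺-trans le (proj₁ (proj₂ thinning) α Sα)

      s-mono : ∀ {γ δ} → γ < δ → S δ → a (s γ) ≺ a (s δ)
      s-mono γ<δ = proj₂ (proj₂ thinning) _ _ γ<δ

      -- Membership in S is squashed to a Boolean so that K embeds in I.
      K : Set ℓ
      K = Σ[ α ∈ I ] T (isYes (em {P = S α}))

      member : (k : K) → S (proj₁ k)
      member (α , α∈S) = toWitness α∈S

      mk : ∀ {α} → S α → K
      mk {α} Sα = α , fromWitness Sα

      K-≡ : {k k′ : K} → proj₁ k ≡ proj₁ k′ → k ≡ k′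
      K-≡ {α , p} {.α , q} refl = cong (α ,_) (T-irrelevant p q)

      _<ᴷ_ : Rel K ℓ
      k <ᴷ k′ = proj₁ k < proj₁ k′

      compareᴷ : Trichotomous _≡_ _<ᴷ_
      compareᴷ k k′ with compare (proj₁ k) (proj₁ k′)
      ... | tri< lt ¬eq ¬gt = tri< lt (¬eq ∘ cong proj₁) ¬gt
      ... | tri≈ ¬lt eq ¬gt = tri≈ ¬lt (K-≡ eq) ¬gt
      ... | tri> ¬lt ¬eq gt = tri> ¬lt (¬eq ∘ cong proj₁) gt

      κ : Cardinal ℓ
      κ = record
        { Carrier = K
        ; _<_ = _<ᴷ_
        ; isStrictTotalOrder = record
          { isStrictPartialOrder = record
            { isEquivalence = isEquivalence
            ; irrefl = λ { refl → <-irrefl }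
            ; trans = <-trans
            ; <-resp-≈ = resp₂ _<ᴷ_
            }
          ; compare = compareᴷ
          }
        ; wellFounded = On.wellFounded proj₁ wellFounded
        ; initial = κ-initial
        }
        where
        -- If `g` embedded `K` below `β`, then `s` composed with an inverse of `g` would be cofinal
        -- on the segment below `β`, although `β` is in `S`.
        κ-initial : ∀ β (g : K → K) → Injective _≡_ _≡_ g → ¬ (∀ α → g α <ᴷ β)
        κ-initial β g inj g<β = S⇒¬cofinal (member β) (h , cof)
          where
          k₀ = mk (proj₁ (proj₂ (s-cofinal i₀)))

          h : I → I
          h γ = s (proj₁ (preimage (proj₁ ∘ g) k₀ γ))

          cof : ∀ i → ∃[ α ] (α < proj₁ β × a i ≼ a (h α))
          cof i =
            let (α , Sα , lt) = s-cofinal i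
                eq = inj (K-≡ (preimage-correct (proj₁ ∘ g) k₀ (mk Sα)))
            in  proj₁ (g (mk Sα)) , g<β (mk Sα) ,
                λ gt → ≺-irrefl (≺-trans lt (subst (λ k → a (s (proj₁ k)) ≺ a i) eq gt))

      κ↣Λ : K ↣ I
      κ↣Λ = mk↣ {to = proj₁} K-≡

      regular : IsInfiniteRegular κ
      regular = record { infinite = infinite ; regular = reg }
        where
        -- Some value of `s` exceeds `a (s α)`, and monotonicity puts its index after `α`.
        above : (k : K) → ∃[ k′ ] k <ᴷ k′
        above (α , α∈S) =
          let (β , Sβ , lt) = s-cofinal (s α)
          in  mk Sβ , (case compare α β of λ where
            (tri< α<β _ _)  → α<β
            (tri≈ _ eq _)   → ⊥-elim (≺-irrefl (subst (λ x → a (s α) ≺ a (s x)) (sym eq) lt))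
            (tri> _ _ β<α)  → ⊥-elim (≺-irrefl (≺-trans lt (s-mono β<α (toWitness α∈S)))))

        seq : ℕ → K
        seq zero    = mk (proj₁ (proj₂ (s-cofinal i₀)))
        seq (suc n) = proj₁ (above (seq n))

        seq-mono : ∀ {m n} → m ℕ.<′ n → seq m <ᴷ seq n
        seq-mono {m} ℕ.<′-base           = proj₂ (above (seq m))
        seq-mono (ℕ.<′-step {n = n} m<n) = <-trans (seq-mono m<n) (proj₂ (above (seq n)))

        infinite : ℕ ↣ K
        infinite = mk↣ {to = seq} λ {m} {n} eq → case ℕₚ.<-cmp m n of λ where
          (tri< m<n _ _) → ⊥-elim (<-irrefl (subst (_<ᴷ seq n) eq (seq-mono (ℕₚ.<⇒<′ m<n))))
          (tri≈ _ m≡n _) → m≡n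
          (tri> _ _ n<m) → ⊥-elim (<-irrefl (subst (seq n <ᴷ_) eq (seq-mono (ℕₚ.<⇒<′ n<m))))

        -- If `g` were unbounded on the segment below `β`, then `s` after `g` would be cofinal on
        -- that segment, although `β` is in `S`.
        reg : ∀ β (g : K → K) → ∃[ γ ] (∀ α → α <ᴷ β → g α <ᴷ γ)
        reg β g with em {P = ∃[ γ ] (∀ α → α <ᴷ β → g α <ᴷ γ)}
        ... | yes bounded = bounded
        ... | no ¬bounded = ⊥-elim (S⇒¬cofinal (member β) (h , cof))
          where
          h : I → I
          h α with em {P = S α}
          ... | yes Sα = s (proj₁ (g (mk Sα)))
          ... | no _   = i₀

          h-eq : ∀ k → h (proj₁ k) ≡ s (proj₁ (g k))
          h-eq k with em {P = S (proj₁ k)}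
          ... | yes Sk = cong (λ k′ → s (proj₁ (g k′))) (K-≡ refl)
          ... | no ¬Sk = ⊥-elim (¬Sk (member k))

          unboundedAt : ∀ γ → ∃[ α ] (α <ᴷ β × ¬ (g α <ᴷ γ))
          unboundedAt γ with em {P = ∃[ α ] (α <ᴷ β × ¬ (g α <ᴷ γ))}
          ... | yes p = p
          ... | no ¬p = ⊥-elim (¬bounded (γ , λ α α<β → case em of λ where
            (yes lt) → lt
            (no ¬lt) → ⊥-elim (¬p (α , α<β , ¬lt))))

          cof : ∀ i → ∃[ α ] (α < proj₁ β × a i ≼ a (h α))
          cof i =
            let (γ , Sγ , lt) = s-cofinal i
                (α , α<β , ¬gt) = unboundedAt (mk Sγ)
            in  proj₁ α , α<β , λ gt → ≺-irrefl (≺-trans lt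
                  (case compare (proj₁ (g α)) γ of λ where
                    (tri< gα<γ _ _) → ⊥-elim (¬gt gα<γ)
                    (tri≈ _ eq _)   → subst (λ x → a x ≺ a i) (trans (h-eq α) (cong s eq)) gt
                    (tri> _ _ γ<gα) → ≺-trans (s-mono γ<gα (member (g α)))
                                        (subst (λ x → a x ≺ a i) (h-eq α) gt)))

      b : K → L
      b = a ∘ s ∘ proj₁

      b-mono : ∀ k k′ → k <ᴷ k′ → b k ≺ b k′
      b-mono k k′ lt = s-mono lt (member k′)

      b-cofinal : ∀ i → ∃[ k ] a i ≺ b k
      b-cofinal i = let (α , Sα , lt) = s-cofinal i in mk Sα , lt

open Equivalence using (to; from)

-- Definability with terms

infix  8 _∈ᵉ_ _≐ᵉ_
infixr 7 _∧ᵉ_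
infixr 6 _∨ᵉ_
infixr 5 _⇒ᵉ_
infixl 9 _·ᵗ_

-- Formulas over terms for ∅, successor, ordered pair and application of
-- set functions; they are translated into Formula by replacing each term by its
-- graph.
data Term (n : ℕ) : Set where
  var  : Fin n → Term n
  ∅ᵗ   : Term n
  Sᵗ   : Term n → Term n
  ⟨_,_⟩ᵗ : Term n → Term n → Term n
  _·ᵗ_ : Term n → Term n → Term n

data ExtFormula (n : ℕ) : Set where
  _∈ᵉ_ _≐ᵉ_      : Term n → Term n → ExtFormula n
  ⊥ᵉ             : ExtFormula n
  _∧ᵉ_ _∨ᵉ_ _⇒ᵉ_ : ExtFormula n → ExtFormula n → ExtFormula n
  ∀ᵉ ∃ᵉ          : ExtFormula (suc n) → ExtFormula n

v0 : ∀ {n} → Term (suc n)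
v0 = var zero
v1 : ∀ {n} → Term (suc (suc n))
v1 = var (suc zero)
v2 : ∀ {n} → Term (suc (suc (suc n)))
v2 = var (suc (suc zero))
v3 : ∀ {n} → Term (suc (suc (suc (suc n))))
v3 = var (suc (suc (suc zero)))
v4 : ∀ {n} → Term (suc (suc (suc (suc (suc n)))))
v4 = var (suc (suc (suc (suc zero))))
v5 : ∀ {n} → Term (suc (suc (suc (suc (suc (suc n))))))
v5 = var (suc (suc (suc (suc (suc zero)))))
v6 : ∀ {n} → Term (suc (suc (suc (suc (suc (suc (suc n)))))))
v6 = var (suc (suc (suc (suc (suc (suc zero))))))
v7 : ∀ {n} → Term (suc (suc (suc (suc (suc (suc (suc (suc n))))))))
v7 = var (suc (suc (suc (suc (suc (suc (suc zero)))))))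

private
  variable
    n m : ℕ

pairᶠ orderedPairᶠ relatedᶠ valueᶠ applicationᶠ : Fin n → Fin n → Fin n → Formula n
pairᶠ p x y =
  ∀ᶠ ((zero ∈ᶠ suc p ⇒ᶠ zero ≐ᶠ suc x ∨ᶠ zero ≐ᶠ suc y) ∧ᶠ
      (zero ≐ᶠ suc x ∨ᶠ zero ≐ᶠ suc y ⇒ᶠ zero ∈ᶠ suc p))
orderedPairᶠ p x y =
  ∃ᶠ (∃ᶠ (pairᶠ (suc zero) (suc (suc x)) (suc (suc x)) ∧ᶠ
          pairᶠ zero (suc (suc x)) (suc (suc y)) ∧ᶠ
          pairᶠ (suc (suc p)) (suc zero) zero))
relatedᶠ r x y = ∃ᶠ (orderedPairᶠ zero (suc x) (suc y) ∧ᶠ zero ∈ᶠ suc r)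
valueᶠ y f x = relatedᶠ f x y ∧ᶠ ∀ᶠ (relatedᶠ (suc f) (suc x) zero ⇒ᶠ zero ≐ᶠ suc y)
applicationᶠ y f x =
  valueᶠ y f x ∨ᶠ
  -- The default: without a unique value at `x` the application is empty.
  (∃ᶠ (valueᶠ zero (suc f) (suc x)) ⇒ᶠ ⊥ᶠ) ∧ᶠ ∀ᶠ (zero ∈ᶠ suc y ⇒ᶠ ⊥ᶠ)

successorᶠ : Fin n → Fin n → Formula n
successorᶠ s x =
  ∀ᶠ ((zero ∈ᶠ suc s ⇒ᶠ zero ∈ᶠ suc x ∨ᶠ zero ≐ᶠ suc x) ∧ᶠ
      (zero ∈ᶠ suc x ∨ᶠ zero ≐ᶠ suc x ⇒ᶠ zero ∈ᶠ suc s))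

_⁺⁺ : (Fin n → Fin m) → Fin n → Fin (suc (suc m))
(σ ⁺⁺) i = suc (suc (σ i))

-- `σ` locates the variables of the term in a context enlarged by the values of its subterms; `y` is
-- the position of the value.
graph : Term n → (Fin n → Fin m) → Fin m → Formula m
graph (var i) σ y = y ≐ᶠ σ i
graph ∅ᵗ σ y = ∀ᶠ (zero ∈ᶠ suc y ⇒ᶠ ⊥ᶠ)
graph (Sᵗ t) σ y = ∃ᶠ (graph t (suc ∘ σ) zero ∧ᶠ successorᶠ (suc y) zero)
graph ⟨ t , u ⟩ᵗ σ y =
  ∃ᶠ (∃ᶠ (graph t (σ ⁺⁺) (suc zero) ∧ᶠ graph u (σ ⁺⁺) zero ∧ᶠ
          orderedPairᶠ (suc (suc y)) (suc zero) zero))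
graph (t ·ᵗ u) σ y =
  ∃ᶠ (∃ᶠ (graph t (σ ⁺⁺) (suc zero) ∧ᶠ graph u (σ ⁺⁺) zero ∧ᶠ
          applicationᶠ (suc (suc y)) (suc zero) zero))

atom : (∀ {m} → Fin m → Fin m → Formula m) → Term n → Term n → Formula n
atom A t u =
  ∃ᶠ (∃ᶠ (graph t (id ⁺⁺) (suc zero) ∧ᶠ graph u (id ⁺⁺) zero ∧ᶠ A (suc zero) zero))

translate : ExtFormula n → Formula n
translate (t ∈ᵉ u) = atom _∈ᶠ_ t u
translate (t ≐ᵉ u) = atom _≐ᶠ_ t u
translate ⊥ᵉ       = ⊥ᶠ
translate (φ ∧ᵉ ψ) = translate φ ∧ᶠ translate ψ
translate (φ ∨ᵉ ψ) = translate φ ∨ᶠ translate ψ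
translate (φ ⇒ᵉ ψ) = translate φ ⇒ᶠ translate ψ
translate (∀ᵉ φ)   = ∀ᶠ (translate φ)
translate (∃ᵉ φ)   = ∃ᶠ (translate φ)

-- Elementary set theory inside the model

module Model (em : ∀ {a} → ExcludedMiddle a)
             {ℓ : Level} (𝕍 : Structure ℓ) (zfc : IsModelOfZFC⁻ 𝕍) where

  open Structure 𝕍 renaming (Carrier to V)
  open IsModelOfZFC⁻ zfc
  open Classical em

  abstract
    ∅ : V
    ∅ = proj₁ (separation {n = 0} ⊥ᶠ [] (proj₁ infinity))

    ∅-empty : ∀ {x} → ¬ (x ∈ ∅)
    ∅-empty x∈∅ = case proj₂ (to (proj₂ (separation {n = 0} ⊥ᶠ [] (proj₁ infinity)) _) x∈∅) of λ ()

    ⦅_,_⦆ : V → V → V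
    ⦅ x , y ⦆ = proj₁ (pairing x y)

    ⦅,⦆-isPair : ∀ x y → IsPair 𝕍 ⦅ x , y ⦆ x y
    ⦅,⦆-isPair x y = proj₂ (pairing x y)

    ⋃ : V → V
    ⋃ x = proj₁ (union x)

    ∈⋃ : ∀ {x z} → z ∈ ⋃ x ⇔ (∃[ y ] (y ∈ x × z ∈ y))
    ∈⋃ {x} {z} = proj₂ (union x) z

  empty-unique : ∀ {x} → IsEmpty 𝕍 x → x ≡ ∅
  empty-unique empty = extensionality _ _ λ z →
    mk⇔ (⊥-elim ∘ empty z) (⊥-elim ∘ ∅-empty)

  ∈⦅⦆⁻ : ∀ {x y z} → z ∈ ⦅ x , y ⦆ → z ≡ x ⊎ z ≡ y
  ∈⦅⦆⁻ {x} {y} {z} = to (⦅,⦆-isPair x y z)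

  ∈⦅⦆ˡ : ∀ {x y} → x ∈ ⦅ x , y ⦆
  ∈⦅⦆ˡ {x} {y} = from (⦅,⦆-isPair x y x) (inj₁ refl)

  ∈⦅⦆ʳ : ∀ {x y} → y ∈ ⦅ x , y ⦆
  ∈⦅⦆ʳ {x} {y} = from (⦅,⦆-isPair x y y) (inj₂ refl)

  ∈⦅x,x⦆ : ∀ {x z} → z ∈ ⦅ x , x ⦆ → z ≡ x
  ∈⦅x,x⦆ z∈ = case ∈⦅⦆⁻ z∈ of λ where
    (inj₁ eq) → eq
    (inj₂ eq) → eq

  pair-unique : ∀ {p x y} → IsPair 𝕍 p x y → p ≡ ⦅ x , y ⦆
  pair-unique {x = x} {y} isPair = extensionality _ _ λ z →
    mk⇔ (from (⦅,⦆-isPair x y z) ∘ to (isPair z)) (from (isPair z) ∘ to (⦅,⦆-isPair x y z))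

  abstract
    S : V → V
    S x = ⋃ ⦅ x , ⦅ x , x ⦆ ⦆

    S-isSuccessor : ∀ x → IsSuccessor 𝕍 (S x) x
    S-isSuccessor x z = mk⇔
      (λ z∈ → let (y , y∈ , z∈y) = to ∈⋃ z∈ in case ∈⦅⦆⁻ y∈ of λ where
        (inj₁ eq) → inj₁ (subst (z ∈_) eq z∈y)
        (inj₂ eq) → inj₂ (∈⦅x,x⦆ (subst (z ∈_) eq z∈y)))
      (λ where
        (inj₁ z∈x)  → from ∈⋃ (_ , ∈⦅⦆ˡ , z∈x)
        (inj₂ refl) → from ∈⋃ (_ , ∈⦅⦆ʳ , ∈⦅⦆ˡ))

  successor-unique : ∀ {s x} → IsSuccessor 𝕍 s x → s ≡ S x
  successor-unique {x = x} isS = extensionality _ _ λ z →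
    mk⇔ (from (S-isSuccessor x z) ∘ to (isS z)) (from (isS z) ∘ to (S-isSuccessor x z))

  abstract
    ⟨_,_⟩ : V → V → V
    ⟨ x , y ⟩ = ⦅ ⦅ x , x ⦆ , ⦅ x , y ⦆ ⦆

    orderedPair⇔ : ∀ {p x y} → IsOrderedPair 𝕍 p x y ⇔ p ≡ ⟨ x , y ⟩
    orderedPair⇔ {p} {x} {y} = mk⇔
      (λ (s , d , isS , isD , isP) →
        trans (pair-unique isP) (cong₂ ⦅_,_⦆ (pair-unique isS) (pair-unique isD)))
      (λ { refl → _ , _ , ⦅,⦆-isPair x x , ⦅,⦆-isPair x y , ⦅,⦆-isPair _ _ })

  related⇔ : ∀ {r x y} → Related 𝕍 r x y ⇔ ⟨ x , y ⟩ ∈ r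
  related⇔ {r} = mk⇔
    (λ (p , isP , p∈r) → subst (_∈ r) (to orderedPair⇔ isP) p∈r)
    (λ ∈r → _ , from orderedPair⇔ refl , ∈r)

  abstract
    -- Kuratowski's argument: `a` lies in both members of `⟨ a , b ⟩`, hence in `⦅ x , x ⦆`. Then
    -- `b` is `x` or `y`, and `y` is `a` or `b`; in the one case without `y ≡ b` at hand, all four
    -- points coincide.
    ⟨,⟩-injective : ∀ {x y a b} → ⟨ x , y ⟩ ≡ ⟨ a , b ⟩ → x ≡ a × y ≡ b
    ⟨,⟩-injective {x} {y} {a} {b} eq = x≡a , y≡b
      where
      x≡a : x ≡ a
      x≡a with ∈⦅⦆⁻ (subst (⦅ x , x ⦆ ∈_) eq ∈⦅⦆ˡ)
      ... | inj₁ e = sym (∈⦅x,x⦆ (subst (a ∈_) (sym e) ∈⦅⦆ˡ))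
      ... | inj₂ e = sym (∈⦅x,x⦆ (subst (a ∈_) (sym e) ∈⦅⦆ˡ))

      b∈ : b ≡ x ⊎ b ≡ y
      b∈ with ∈⦅⦆⁻ (subst (⦅ a , b ⦆ ∈_) (sym eq) ∈⦅⦆ʳ)
      ... | inj₁ e = inj₁ (∈⦅x,x⦆ (subst (b ∈_) e ∈⦅⦆ʳ))
      ... | inj₂ e = ∈⦅⦆⁻ (subst (b ∈_) e ∈⦅⦆ʳ)

      y∈ : y ≡ a ⊎ y ≡ b
      y∈ with ∈⦅⦆⁻ (subst (⦅ x , y ⦆ ∈_) eq ∈⦅⦆ʳ)
      ... | inj₁ e = inj₁ (∈⦅x,x⦆ (subst (y ∈_) e ∈⦅⦆ʳ))
      ... | inj₂ e = ∈⦅⦆⁻ (subst (y ∈_) e ∈⦅⦆ʳ)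

      y≡b : y ≡ b
      y≡b with y∈ | b∈
      ... | inj₂ e | _       = e
      ... | inj₁ _ | inj₂ e  = sym e
      ... | inj₁ e | inj₁ e′ = trans e (trans (sym x≡a) (sym e′))

  IsValue : V → V → V → Set ℓ
  IsValue f x y = ⟨ x , y ⟩ ∈ f × (∀ z → ⟨ x , z ⟩ ∈ f → z ≡ y)

  -- f · x is ∅ unless f has exactly one value at x.
  infixl 9 _·_
  abstract
    _·_ : V → V → V
    f · x = choose ∅ (IsValue f x)

    ·-correct : ∀ {f x} → ∃ (IsValue f x) → IsValue f x (f · x)
    ·-correct = choose-correct ∅ _

    ·-junk : ∀ {f x} → ¬ ∃ (IsValue f x) → f · x ≡ ∅
    ·-junk {f} {x} ∄ with em {P = ∃ (IsValue f x)}
    ... | yes ∃v = ⊥-elim (∄ ∃v)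
    ... | no _   = refl

  ·-unique : ∀ {f x y} → IsValue f x y → y ≡ f · x
  ·-unique isV@(xy∈f , _) = proj₂ (·-correct (_ , isV)) _ xy∈f

  module _ (ρ : Vec V m) where
    pairᶠ⇔ : ∀ p x y → Sat 𝕍 (pairᶠ p x y) ρ ⇔ IsPair 𝕍 (lookup ρ p) (lookup ρ x) (lookup ρ y)
    pairᶠ⇔ p x y = mk⇔ (λ h z → mk⇔ (proj₁ (h z)) (proj₂ (h z))) (λ h z → to (h z) , from (h z))

    successorᶠ⇔ : ∀ s x → Sat 𝕍 (successorᶠ s x) ρ ⇔ lookup ρ s ≡ S (lookup ρ x)
    successorᶠ⇔ s x = mk⇔
      (λ h → successor-unique λ z → mk⇔ (proj₁ (h z)) (proj₂ (h z)))
      (λ eq z → subst (λ s → (z ∈ s → z ∈ lookup ρ x ⊎ z ≡ lookup ρ x) ×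
                             (z ∈ lookup ρ x ⊎ z ≡ lookup ρ x → z ∈ s)) (sym eq)
                  (to (S-isSuccessor (lookup ρ x) z) , from (S-isSuccessor (lookup ρ x) z)))

    emptyᶠ⇔ : ∀ y → Sat 𝕍 (∀ᶠ (zero ∈ᶠ suc y ⇒ᶠ ⊥ᶠ)) ρ ⇔ lookup ρ y ≡ ∅
    emptyᶠ⇔ y = mk⇔
      (λ h → empty-unique λ z z∈y → case h z z∈y of λ ())
      (λ eq z z∈y → ⊥-elim (∅-empty (subst (z ∈_) eq z∈y)))

  orderedPairᶠ⇔ : ∀ (ρ : Vec V m) p x y →
    Sat 𝕍 (orderedPairᶠ p x y) ρ ⇔ lookup ρ p ≡ ⟨ lookup ρ x , lookup ρ y ⟩
  orderedPairᶠ⇔ ρ p x y = mk⇔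
    (λ (s , d , isS , isD , isP) → let ρ′ = d ∷ s ∷ ρ in
      to orderedPair⇔ (s , d , to (pairᶠ⇔ ρ′ (suc zero) (suc (suc x)) (suc (suc x))) isS ,
                              to (pairᶠ⇔ ρ′ zero (suc (suc x)) (suc (suc y))) isD ,
                              to (pairᶠ⇔ ρ′ (suc (suc p)) (suc zero) zero) isP))
    (λ eq → let (s , d , isS , isD , isP) = from orderedPair⇔ eq
                ρ′ = d ∷ s ∷ ρ in
      s , d , from (pairᶠ⇔ ρ′ (suc zero) (suc (suc x)) (suc (suc x))) isS ,
              from (pairᶠ⇔ ρ′ zero (suc (suc x)) (suc (suc y))) isD ,
              from (pairᶠ⇔ ρ′ (suc (suc p)) (suc zero) zero) isP)

  relatedᶠ⇔ : ∀ (ρ : Vec V m) r x y →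
    Sat 𝕍 (relatedᶠ r x y) ρ ⇔ ⟨ lookup ρ x , lookup ρ y ⟩ ∈ lookup ρ r
  relatedᶠ⇔ ρ r x y = mk⇔
    (λ (p , isP , p∈r) → subst (_∈ _) (to (orderedPairᶠ⇔ (p ∷ ρ) zero (suc x) (suc y)) isP) p∈r)
    (λ ∈r → _ , from (orderedPairᶠ⇔ (_ ∷ ρ) zero (suc x) (suc y)) refl , ∈r)

  valueᶠ⇔ : ∀ (ρ : Vec V m) y f x →
    Sat 𝕍 (valueᶠ y f x) ρ ⇔ IsValue (lookup ρ f) (lookup ρ x) (lookup ρ y)
  valueᶠ⇔ ρ y f x = mk⇔
    (λ (xy∈f , uniq) → to (relatedᶠ⇔ ρ f x y) xy∈f ,
      λ z xz∈f → uniq z (from (relatedᶠ⇔ (z ∷ ρ) (suc f) (suc x) zero) xz∈f))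
    (λ (xy∈f , uniq) → from (relatedᶠ⇔ ρ f x y) xy∈f ,
      λ z xz∈f → uniq z (to (relatedᶠ⇔ (z ∷ ρ) (suc f) (suc x) zero) xz∈f))

  applicationᶠ⇔ : ∀ (ρ : Vec V m) y f x →
    Sat 𝕍 (applicationᶠ y f x) ρ ⇔ lookup ρ y ≡ lookup ρ f · lookup ρ x
  applicationᶠ⇔ ρ y f x = mk⇔ fwd bwd
    where
    fwd : Sat 𝕍 (applicationᶠ y f x) ρ → lookup ρ y ≡ lookup ρ f · lookup ρ x
    fwd (inj₁ isV)        = ·-unique (to (valueᶠ⇔ ρ y f x) isV)
    fwd (inj₂ (∄ , empty)) = trans (to (emptyᶠ⇔ ρ y) empty) (sym (·-junk λ (z , isV) →
      case ∄ (z , from (valueᶠ⇔ (z ∷ ρ) zero (suc f) (suc x)) isV) of λ ()))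

    bwd : lookup ρ y ≡ lookup ρ f · lookup ρ x → Sat 𝕍 (applicationᶠ y f x) ρ
    bwd eq with em {P = ∃ (IsValue (lookup ρ f) (lookup ρ x))}
    ... | yes ∃v = inj₁ (from (valueᶠ⇔ ρ y f x) (subst (IsValue _ _) (sym eq) (·-correct ∃v)))
    ... | no ∄v  = inj₂
      ((λ (z , isV) → ⊥-elim (∄v (z , to (valueᶠ⇔ (z ∷ ρ) zero (suc f) (suc x)) isV))) ,
       from (emptyᶠ⇔ ρ y) (trans eq (·-junk ∄v)))

  ⟦_⟧ᵗ : Term n → Vec V n → V
  ⟦ var i ⟧ᵗ      ρ = lookup ρ i
  ⟦ ∅ᵗ ⟧ᵗ         ρ = ∅
  ⟦ Sᵗ t ⟧ᵗ       ρ = S (⟦ t ⟧ᵗ ρ)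
  ⟦ ⟨ t , u ⟩ᵗ ⟧ᵗ ρ = ⟨ ⟦ t ⟧ᵗ ρ , ⟦ u ⟧ᵗ ρ ⟩
  ⟦ t ·ᵗ u ⟧ᵗ     ρ = ⟦ t ⟧ᵗ ρ · ⟦ u ⟧ᵗ ρ

  ⟦_⟧ : ExtFormula n → Vec V n → Set ℓ
  ⟦ t ∈ᵉ u ⟧ ρ = ⟦ t ⟧ᵗ ρ ∈ ⟦ u ⟧ᵗ ρ
  ⟦ t ≐ᵉ u ⟧ ρ = ⟦ t ⟧ᵗ ρ ≡ ⟦ u ⟧ᵗ ρ
  ⟦ ⊥ᵉ ⟧     ρ = Poly.⊥
  ⟦ φ ∧ᵉ ψ ⟧ ρ = ⟦ φ ⟧ ρ × ⟦ ψ ⟧ ρ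
  ⟦ φ ∨ᵉ ψ ⟧ ρ = ⟦ φ ⟧ ρ ⊎ ⟦ ψ ⟧ ρ
  ⟦ φ ⇒ᵉ ψ ⟧ ρ = ⟦ φ ⟧ ρ → ⟦ ψ ⟧ ρ
  ⟦ ∀ᵉ φ ⟧   ρ = ∀ x → ⟦ φ ⟧ (x ∷ ρ)
  ⟦ ∃ᵉ φ ⟧   ρ = ∃[ x ] ⟦ φ ⟧ (x ∷ ρ)

  -- Stated for a larger environment `ρ′` so that the induction passes under the quantifiers binding
  -- intermediate values; `agree` is preserved definitionally.
  graph⇔ : (t : Term n) (ρ : Vec V n) (ρ′ : Vec V m) (σ : Fin n → Fin m) →
           (∀ i → lookup ρ′ (σ i) ≡ lookup ρ i) →
           ∀ y → Sat 𝕍 (graph t σ y) ρ′ ⇔ lookup ρ′ y ≡ ⟦ t ⟧ᵗ ρ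
  graph⇔ (var i) ρ ρ′ σ agree y = mk⇔ (λ eq → trans eq (agree i)) (λ eq → trans eq (sym (agree i)))
  graph⇔ ∅ᵗ ρ ρ′ σ agree y = emptyᶠ⇔ ρ′ y
  graph⇔ (Sᵗ t) ρ ρ′ σ agree y = mk⇔
    (λ (a , isA , isS) →
      trans (to (successorᶠ⇔ (a ∷ ρ′) (suc y) zero) isS)
            (cong S (to (graph⇔ t ρ (a ∷ ρ′) (suc ∘ σ) agree zero) isA)))
    (λ eq → _ , from (graph⇔ t ρ (_ ∷ ρ′) (suc ∘ σ) agree zero) refl ,
                from (successorᶠ⇔ (_ ∷ ρ′) (suc y) zero) eq)
  graph⇔ ⟨ t , u ⟩ᵗ ρ ρ′ σ agree y = mk⇔
    (λ (a , b , isA , isB , isP) →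
      trans (to (orderedPairᶠ⇔ (b ∷ a ∷ ρ′) (suc (suc y)) (suc zero) zero) isP)
            (cong₂ ⟨_,_⟩ (to (graph⇔ t ρ (b ∷ a ∷ ρ′) (σ ⁺⁺) agree (suc zero)) isA)
                         (to (graph⇔ u ρ (b ∷ a ∷ ρ′) (σ ⁺⁺) agree zero) isB)))
    (λ eq → _ , _ , from (graph⇔ t ρ (_ ∷ _ ∷ ρ′) (σ ⁺⁺) agree (suc zero)) refl ,
                    from (graph⇔ u ρ (_ ∷ _ ∷ ρ′) (σ ⁺⁺) agree zero) refl ,
                    from (orderedPairᶠ⇔ (_ ∷ _ ∷ ρ′) (suc (suc y)) (suc zero) zero) eq)
  graph⇔ (t ·ᵗ u) ρ ρ′ σ agree y = mk⇔
    (λ (a , b , isA , isB , isP) →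
      trans (to (applicationᶠ⇔ (b ∷ a ∷ ρ′) (suc (suc y)) (suc zero) zero) isP)
            (cong₂ _·_ (to (graph⇔ t ρ (b ∷ a ∷ ρ′) (σ ⁺⁺) agree (suc zero)) isA)
                       (to (graph⇔ u ρ (b ∷ a ∷ ρ′) (σ ⁺⁺) agree zero) isB)))
    (λ eq → _ , _ , from (graph⇔ t ρ (_ ∷ _ ∷ ρ′) (σ ⁺⁺) agree (suc zero)) refl ,
                    from (graph⇔ u ρ (_ ∷ _ ∷ ρ′) (σ ⁺⁺) agree zero) refl ,
                    from (applicationᶠ⇔ (_ ∷ _ ∷ ρ′) (suc (suc y)) (suc zero) zero) eq)

  translate⇔ : (φ : ExtFormula n) (ρ : Vec V n) → Sat 𝕍 (translate φ) ρ ⇔ ⟦ φ ⟧ ρ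
  translate⇔ (t ∈ᵉ u) ρ = mk⇔
    (λ (a , b , isA , isB , a∈b) →
      subst₂ _∈_ (to (graph⇔ t ρ (b ∷ a ∷ ρ) (id ⁺⁺) (λ _ → refl) (suc zero)) isA)
                 (to (graph⇔ u ρ (b ∷ a ∷ ρ) (id ⁺⁺) (λ _ → refl) zero) isB) a∈b)
    (λ t∈u → _ , _ , from (graph⇔ t ρ (_ ∷ _ ∷ ρ) (id ⁺⁺) (λ _ → refl) (suc zero)) refl ,
                     from (graph⇔ u ρ (_ ∷ _ ∷ ρ) (id ⁺⁺) (λ _ → refl) zero) refl , t∈u)
  translate⇔ (t ≐ᵉ u) ρ = mk⇔
    (λ (a , b , isA , isB , a≡b) →
      subst₂ _≡_ (to (graph⇔ t ρ (b ∷ a ∷ ρ) (id ⁺⁺) (λ _ → refl) (suc zero)) isA)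
                 (to (graph⇔ u ρ (b ∷ a ∷ ρ) (id ⁺⁺) (λ _ → refl) zero) isB) a≡b)
    (λ t≡u → _ , _ , from (graph⇔ t ρ (_ ∷ _ ∷ ρ) (id ⁺⁺) (λ _ → refl) (suc zero)) refl ,
                     from (graph⇔ u ρ (_ ∷ _ ∷ ρ) (id ⁺⁺) (λ _ → refl) zero) refl , t≡u)
  translate⇔ ⊥ᵉ ρ = mk⇔ (λ ()) (λ ())
  translate⇔ (φ ∧ᵉ ψ) ρ = mk⇔
    (λ (p , q) → to (translate⇔ φ ρ) p , to (translate⇔ ψ ρ) q)
    (λ (p , q) → from (translate⇔ φ ρ) p , from (translate⇔ ψ ρ) q)
  translate⇔ (φ ∨ᵉ ψ) ρ = mk⇔
    (λ { (inj₁ p) → inj₁ (to (translate⇔ φ ρ) p) ; (inj₂ q) → inj₂ (to (translate⇔ ψ ρ) q) })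
    (λ { (inj₁ p) → inj₁ (from (translate⇔ φ ρ) p) ; (inj₂ q) → inj₂ (from (translate⇔ ψ ρ) q) })
  translate⇔ (φ ⇒ᵉ ψ) ρ = mk⇔
    (λ f p → to (translate⇔ ψ ρ) (f (from (translate⇔ φ ρ) p)))
    (λ f p → from (translate⇔ ψ ρ) (f (to (translate⇔ φ ρ) p)))
  translate⇔ (∀ᵉ φ) ρ = mk⇔
    (λ f x → to (translate⇔ φ (x ∷ ρ)) (f x)) (λ f x → from (translate⇔ φ (x ∷ ρ)) (f x))
  translate⇔ (∃ᵉ φ) ρ = mk⇔
    (λ (x , p) → x , to (translate⇔ φ (x ∷ ρ)) p) (λ (x , p) → x , from (translate⇔ φ (x ∷ ρ)) p)

  abstract
    sep : ExtFormula (suc n) → Vec V n → V → V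
    sep φ ρ x = proj₁ (separation (translate φ) ρ x)

    ∈sep⁻ : ∀ (φ : ExtFormula (suc n)) {ρ x z} → z ∈ sep φ ρ x → z ∈ x × ⟦ φ ⟧ (z ∷ ρ)
    ∈sep⁻ φ {ρ} {x} {z} z∈ =
      let (z∈x , sat) = to (proj₂ (separation (translate φ) ρ x) z) z∈
      in  z∈x , to (translate⇔ φ (z ∷ ρ)) sat

    ∈sep⁺ : ∀ (φ : ExtFormula (suc n)) {ρ x z} → z ∈ x → ⟦ φ ⟧ (z ∷ ρ) → z ∈ sep φ ρ x
    ∈sep⁺ φ {ρ} {x} {z} z∈x p =
      from (proj₂ (separation (translate φ) ρ x) z) (z∈x , from (translate⇔ φ (z ∷ ρ)) p)

    collect : (φ : ExtFormula (suc (suc n))) (ρ : Vec V n) (x : V) →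
              (∀ u → u ∈ x → ∃[ v ] ⟦ φ ⟧ (v ∷ u ∷ ρ)) →
              ∃[ y ] (∀ u → u ∈ x → ∃[ v ] (v ∈ y × ⟦ φ ⟧ (v ∷ u ∷ ρ)))
    collect φ ρ x total =
      let (y , h) = collection (translate φ) ρ x
                      (λ u u∈x → let (v , p) = total u u∈x in v , from (translate⇔ φ _) p)
      in  y , λ u u∈x → let (v , v∈y , p) = h u u∈x in v , v∈y , to (translate⇔ φ _) p

    -- The powerset axiom being absent, A × B is found by collecting first the
    -- pairs ⟨ u , v ⟩ for fixed u, then the resulting sets.
    product⊇ : ∀ A B → ∃[ P ] (∀ u v → u ∈ A → v ∈ B → ⟨ u , v ⟩ ∈ P)
    product⊇ A B =
      let (Y , h) = collect (∀ᵉ (v0 ∈ᵉ v3 ⇒ᵉ ⟨ v2 , v0 ⟩ᵗ ∈ᵉ v1)) (B ∷ []) A λ u _ →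
            let (y , h) = collect (v0 ≐ᵉ ⟨ v2 , v1 ⟩ᵗ) (u ∷ []) B λ v _ → ⟨ u , v ⟩ , refl
            in  y , λ v v∈B → let (p , p∈y , eq) = h v v∈B in subst (_∈ y) eq p∈y
      in  ⋃ Y , λ u v u∈A v∈B → let (w , w∈Y , h′) = h u u∈A in from ∈⋃ (w , w∈Y , h′ v v∈B)

  private
    pairφ : ExtFormula 3
    pairφ = ∃ᵉ (∃ᵉ (v1 ∈ᵉ v3 ∧ᵉ v0 ∈ᵉ v4 ∧ᵉ v2 ≐ᵉ ⟨ v1 , v0 ⟩ᵗ))

  infixr 2 _×ˢ_
  abstract
    _×ˢ_ : V → V → V
    A ×ˢ B = sep pairφ (A ∷ B ∷ []) (proj₁ (product⊇ A B))

    ∈×⁺ : ∀ {A B u v} → u ∈ A → v ∈ B → ⟨ u , v ⟩ ∈ (A ×ˢ B)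
    ∈×⁺ u∈A v∈B = ∈sep⁺ pairφ (proj₂ (product⊇ _ _) _ _ u∈A v∈B) (_ , _ , u∈A , v∈B , refl)

    ∈×⁻ : ∀ {A B p} → p ∈ (A ×ˢ B) → ∃[ u ] ∃[ v ] (u ∈ A × v ∈ B × p ≡ ⟨ u , v ⟩)
    ∈×⁻ p∈ = proj₂ (∈sep⁻ pairφ p∈)

  ∈×⁻′ : ∀ {A B u v} → ⟨ u , v ⟩ ∈ (A ×ˢ B) → u ∈ A × v ∈ B
  ∈×⁻′ p∈ with ∈×⁻ p∈
  ... | _ , _ , u∈A , v∈B , eq with ⟨,⟩-injective eq
  ...   | refl , refl = u∈A , v∈B

  private
    graphφ : ExtFormula (suc (suc (suc n))) → ExtFormula (suc n)
    graphφ φ = ∃ᵉ (∃ᵉ (v2 ≐ᵉ ⟨ v1 , v0 ⟩ᵗ ∧ᵉ φ))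

  -- In φ, variable 0 is the value, variable 1 the argument, and variable 2
  -- their pair.
  function : ExtFormula (suc (suc (suc n))) → Vec V n → V → V → V
  function φ ρ A B = sep (graphφ φ) ρ (A ×ˢ B)

  -- Uniqueness is asked at the single argument `x` and among values in `B`, so `φ` may fail to be
  -- functional elsewhere.
  function-value : ∀ (φ : ExtFormula (suc (suc (suc n)))) {ρ A B x y} → x ∈ A → y ∈ B →
    ⟦ φ ⟧ (y ∷ x ∷ ⟨ x , y ⟩ ∷ ρ) →
    (∀ z → z ∈ B → ⟦ φ ⟧ (z ∷ x ∷ ⟨ x , z ⟩ ∷ ρ) → z ≡ y) →
    function φ ρ A B · x ≡ y
  function-value φ {ρ} {A} {B} {x} {y} x∈A y∈B p uniq = sym (·-unique
    (∈sep⁺ (graphφ φ) (∈×⁺ x∈A y∈B) (x , y , refl , p) , only))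
    where
    only : ∀ z → ⟨ x , z ⟩ ∈ function φ ρ A B → z ≡ y
    only z z∈ with ∈sep⁻ (graphφ φ) z∈
    ... | z∈AB , x′ , z′ , eq , q with ⟨,⟩-injective eq
    ...   | refl , refl = uniq z (proj₂ (∈×⁻′ z∈AB)) q

-- Arithmetic in ω̂

module Omega (em : ∀ {a} → ExcludedMiddle a)
             {ℓ : Level} (𝕍 : Structure ℓ) (zfc : IsModelOfZFC⁻ 𝕍)
             (ω : Structure.Carrier 𝕍) (isOmega : IsOmega 𝕍 ω) where

  open Structure 𝕍 renaming (Carrier to V)
  open IsModelOfZFC⁻ zfc using (foundation)
  open Model em 𝕍 zfc

  x∈Sx : ∀ {x} → x ∈ S x
  x∈Sx {x} = from (S-isSuccessor x x) (inj₂ refl)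

  ∈⇒∈S : ∀ {x y} → y ∈ x → y ∈ S x
  ∈⇒∈S {x} {y} y∈x = from (S-isSuccessor x y) (inj₁ y∈x)

  ∈S⁻ : ∀ {x y} → y ∈ S x → y ∈ x ⊎ y ≡ x
  ∈S⁻ {x} {y} = to (S-isSuccessor x y)

  ∅≢S : ∀ {x} → ∅ ≢ S x
  ∅≢S eq = ∅-empty (subst (_ ∈_) (sym eq) x∈Sx)

  ∅∈ω : ∅ ∈ ω
  ∅∈ω with proj₁ (proj₁ isOmega)
  ... | e , empty , e∈ω = subst (_∈ ω) (empty-unique empty) e∈ω

  S∈ω : ∀ {x} → x ∈ ω → S x ∈ ω
  S∈ω x∈ω with proj₂ (proj₁ isOmega) _ x∈ω
  ... | s , isS , s∈ω = subst (_∈ ω) (successor-unique isS) s∈ω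

  abstract
    -- The subset of `ω` cut out by `φ` is inductive, and `ω` is the least inductive set. Only
    -- properties definable in the model admit induction, hence the explicit formulas in the proofs
    -- that follow.
    ω-induction : (φ : ExtFormula (suc n)) (ρ : Vec V n) → ⟦ φ ⟧ (∅ ∷ ρ) →
                  (∀ x → x ∈ ω → ⟦ φ ⟧ (x ∷ ρ) → ⟦ φ ⟧ (S x ∷ ρ)) →
                  ∀ x → x ∈ ω → ⟦ φ ⟧ (x ∷ ρ)
    ω-induction φ ρ base step x x∈ω =
      proj₂ (∈sep⁻ φ (proj₂ isOmega (sep φ ρ ω)
        ((∅ , (λ _ → ∅-empty) , ∈sep⁺ φ ∅∈ω base) ,
         λ y y∈ → let (y∈ω , p) = ∈sep⁻ φ y∈ in
           S y , S-isSuccessor y , ∈sep⁺ φ (S∈ω y∈ω) (step y y∈ω p))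
        x x∈ω))

  infix 4 _≤_
  _≤_ : Rel V ℓ
  x ≤ y = x ∈ y ⊎ x ≡ y

  ≤⇒∈S : ∀ {x y} → x ≤ y → x ∈ S y
  ≤⇒∈S {x} {y} = from (S-isSuccessor y x)

  -- Foundation for the singleton of `x`.
  ∈-irrefl : ∀ {x} → ¬ (x ∈ x)
  ∈-irrefl {x} x∈x with foundation ⦅ x , x ⦆ (x , ∈⦅⦆ˡ)
  ... | y , y∈ , disjoint = disjoint x (subst (x ∈_) (sym (∈⦅x,x⦆ y∈)) x∈x) ∈⦅⦆ˡ

  ∈-trans : ∀ {x y z} → z ∈ ω → x ∈ y → y ∈ z → x ∈ z
  ∈-trans {x} {y} {z} z∈ω x∈y y∈z =
    ω-induction (∀ᵉ (∀ᵉ (v1 ∈ᵉ v2 ⇒ᵉ v0 ∈ᵉ v1 ⇒ᵉ v0 ∈ᵉ v2))) []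
      (λ _ _ y∈∅ → ⊥-elim (∅-empty y∈∅))
      (λ z _ ih y x y∈Sz x∈y → ∈⇒∈S (case ∈S⁻ y∈Sz of λ where
        (inj₁ y∈z) → ih y x y∈z x∈y
        (inj₂ eq)  → subst (x ∈_) eq x∈y))
      z z∈ω y x y∈z x∈y

  ∈ω-trans : ∀ {x y} → x ∈ y → y ∈ ω → x ∈ ω
  ∈ω-trans {x} {y} x∈y y∈ω =
    ω-induction (∀ᵉ (v0 ∈ᵉ v1 ⇒ᵉ v0 ∈ᵉ v2)) (ω ∷ [])
      (λ _ x∈∅ → ⊥-elim (∅-empty x∈∅))
      (λ y y∈ω ih x x∈Sy → case ∈S⁻ x∈Sy of λ where
        (inj₁ x∈y) → ih x x∈y
        (inj₂ eq)  → subst (_∈ ω) (sym eq) y∈ω)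
      y y∈ω x x∈y

  ∈-asym : ∀ {x y} → x ∈ ω → x ∈ y → ¬ (y ∈ x)
  ∈-asym x∈ω x∈y y∈x = ∈-irrefl (∈-trans x∈ω x∈y y∈x)

  ∅≤ : ∀ {x} → x ∈ ω → ∅ ≤ x
  ∅≤ {x} = ω-induction (∅ᵗ ∈ᵉ v0 ∨ᵉ ∅ᵗ ≐ᵉ v0) [] (inj₂ refl)
    (λ _ _ ∅≤x → inj₁ (≤⇒∈S ∅≤x)) x

  S≤ : ∀ {x y} → y ∈ ω → x ∈ y → S x ≤ y
  S≤ {x} {y} y∈ω x∈y =
    ω-induction (∀ᵉ (v0 ∈ᵉ v1 ⇒ᵉ Sᵗ v0 ∈ᵉ v1 ∨ᵉ Sᵗ v0 ≐ᵉ v1)) []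
      (λ _ x∈∅ → ⊥-elim (∅-empty x∈∅))
      (λ y _ ih x x∈Sy → case ∈S⁻ x∈Sy of λ where
        (inj₁ x∈y) → inj₁ (≤⇒∈S (ih x x∈y))
        (inj₂ eq)  → inj₂ (cong S eq))
      y y∈ω x x∈y

  ∈-or-≥ : ∀ {x y} → x ∈ ω → y ∈ ω → x ∈ y ⊎ y ≤ x
  ∈-or-≥ {x} {y} x∈ω y∈ω =
    ω-induction (∀ᵉ (v0 ∈ᵉ v2 ⇒ᵉ v1 ∈ᵉ v0 ∨ᵉ v0 ∈ᵉ v1 ∨ᵉ v0 ≐ᵉ v1)) (ω ∷ [])
      (λ y y∈ω → case ∅≤ y∈ω of λ where
        (inj₁ lt) → inj₁ lt
        (inj₂ eq) → inj₂ (inj₂ (sym eq)))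
      (λ x _ ih y y∈ω → case ih y y∈ω of λ where
        (inj₁ x∈y) → case S≤ y∈ω x∈y of λ where
          (inj₁ lt) → inj₁ lt
          (inj₂ eq) → inj₂ (inj₂ (sym eq))
        (inj₂ y≤x) → inj₂ (inj₁ (≤⇒∈S y≤x)))
      x x∈ω y y∈ω

  ∈-≤-trans : ∀ {x y z} → z ∈ ω → x ∈ y → y ≤ z → x ∈ z
  ∈-≤-trans z∈ω x∈y (inj₁ y∈z)  = ∈-trans z∈ω x∈y y∈z
  ∈-≤-trans z∈ω x∈y (inj₂ refl) = x∈y

  ≤-∈-trans : ∀ {x y z} → z ∈ ω → x ≤ y → y ∈ z → x ∈ z
  ≤-∈-trans z∈ω (inj₁ x∈y)  y∈z = ∈-trans z∈ω x∈y y∈z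
  ≤-∈-trans z∈ω (inj₂ refl) y∈z = y∈z

  ≤-trans : ∀ {x y z} → z ∈ ω → x ≤ y → y ≤ z → x ≤ z
  ≤-trans z∈ω x≤y (inj₁ y∈z)  = inj₁ (≤-∈-trans z∈ω x≤y y∈z)
  ≤-trans z∈ω x≤y (inj₂ refl) = x≤y

  ≤⇒∌ : ∀ {x y} → x ∈ ω → x ≤ y → ¬ (y ∈ x)
  ≤⇒∌ x∈ω (inj₁ x∈y)  y∈x = ∈-asym x∈ω x∈y y∈x
  ≤⇒∌ x∈ω (inj₂ refl) x∈x = ∈-irrefl x∈x

  ≤-antisym : ∀ {x y} → x ∈ ω → x ≤ y → y ≤ x → x ≡ y
  ≤-antisym x∈ω x≤y (inj₁ y∈x) = ⊥-elim (≤⇒∌ x∈ω x≤y y∈x)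
  ≤-antisym x∈ω x≤y (inj₂ eq)  = sym eq

  S-injective : ∀ {x y} → y ∈ ω → S x ≡ S y → x ≡ y
  S-injective {x} {y} y∈ω eq =
    case ∈S⁻ (subst (x ∈_) eq x∈Sx) , ∈S⁻ (subst (y ∈_) (sym eq) x∈Sx) of λ where
      (inj₂ x≡y , _)        → x≡y
      (inj₁ x∈y , inj₁ y∈x) → ⊥-elim (∈-asym y∈ω y∈x x∈y)
      (inj₁ x∈y , inj₂ y≡x) → sym y≡x

  zero-or-S : ∀ {x} → x ∈ ω → x ≡ ∅ ⊎ ∃[ y ] (y ∈ ω × x ≡ S y)
  zero-or-S {x} = ω-induction (v0 ≐ᵉ ∅ᵗ ∨ᵉ ∃ᵉ (v0 ∈ᵉ v2 ∧ᵉ v1 ≐ᵉ Sᵗ v0)) (ω ∷ [])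
    (inj₁ refl) (λ y y∈ω _ → inj₂ (y , y∈ω , refl)) x

  abstract
    -- Foundation yields a member minimal for `∈`, and comparability in `ω` makes it least.
    ω-least : (φ : ExtFormula (suc n)) (ρ : Vec V n) {x : V} → x ∈ ω → ⟦ φ ⟧ (x ∷ ρ) →
              ∃[ l ] (l ∈ ω × ⟦ φ ⟧ (l ∷ ρ) × (∀ y → y ∈ ω → ⟦ φ ⟧ (y ∷ ρ) → l ≤ y))
    ω-least φ ρ x∈ω px with foundation (sep φ ρ ω) (_ , ∈sep⁺ φ x∈ω px)
    ... | l , l∈ , minimal with ∈sep⁻ φ l∈
    ...   | l∈ω , pl = l , l∈ω , pl , λ y y∈ω py → case ∈-or-≥ y∈ω l∈ω of λ where
      (inj₁ y∈l) → ⊥-elim (minimal y y∈l (∈sep⁺ φ y∈ω py))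
      (inj₂ l≤y) → l≤y

  numeral : ℕ → V
  numeral zero    = ∅
  numeral (suc k) = S (numeral k)

  numeral∈ω : ∀ k → numeral k ∈ ω
  numeral∈ω zero    = ∅∈ω
  numeral∈ω (suc k) = S∈ω (numeral∈ω k)

  numeral-isNumeral : ∀ k → IsNumeral 𝕍 k (numeral k)
  numeral-isNumeral zero    = λ _ → ∅-empty
  numeral-isNumeral (suc k) = numeral k , numeral-isNumeral k , S-isSuccessor _

  -- External induction on `k`: the numerals form an initial segment of `ω`.
  ≤numeral : ∀ k {x} → x ≤ numeral k → ∃[ j ] x ≡ numeral j
  ≤numeral k       (inj₂ eq) = k , eq
  ≤numeral zero    (inj₁ x∈) = ⊥-elim (∅-empty x∈)
  ≤numeral (suc k) (inj₁ x∈) = ≤numeral k (∈S⁻ x∈)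

  -- The graph of iteration, as a set of ⟨ ⟨ a , j ⟩ , y ⟩, is the intersection of
  -- all sets that contain each ⟨ ⟨ a , ∅ ⟩ , a ⟩ and are closed under the step.
  module Iteration (A g : V) (g-closed : ∀ {y} → y ∈ A → g · y ∈ A) where
    private abstract
      closedφ : ExtFormula 4
      closedφ = ∀ᵉ (v0 ∈ᵉ v3 ⇒ᵉ ⟨ ⟨ v0 , ∅ᵗ ⟩ᵗ , v0 ⟩ᵗ ∈ᵉ v1) ∧ᵉ
                ∀ᵉ (∀ᵉ (∀ᵉ (⟨ ⟨ v2 , v1 ⟩ᵗ , v0 ⟩ᵗ ∈ᵉ v3 ⇒ᵉ
                            ⟨ ⟨ v2 , Sᵗ v1 ⟩ᵗ , v6 ·ᵗ v0 ⟩ᵗ ∈ᵉ v3)))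

      iterφ : ExtFormula 3
      iterφ = ∀ᵉ (closedφ ⇒ᵉ v1 ∈ᵉ v0)

      Π : V
      Π = (A ×ˢ ω) ×ˢ A

    abstract
      iter : V
      iter = sep iterφ (A ∷ g ∷ []) Π

    private abstract
      ∈Π : ∀ {a j y} → ⟨ ⟨ a , j ⟩ , y ⟩ ∈ iter → a ∈ A × j ∈ ω × y ∈ A
      ∈Π h = let (aj∈ , y∈A) = ∈×⁻′ (proj₁ (∈sep⁻ iterφ h))
                 (a∈A , j∈ω) = ∈×⁻′ aj∈
             in  a∈A , j∈ω , y∈A

      base : ∀ {a} → a ∈ A → ⟨ ⟨ a , ∅ ⟩ , a ⟩ ∈ iter
      base a∈A = ∈sep⁺ iterφ (∈×⁺ (∈×⁺ a∈A ∅∈ω) a∈A) (λ R closed → proj₁ closed _ a∈A)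

      step : ∀ {a j y} → ⟨ ⟨ a , j ⟩ , y ⟩ ∈ iter → ⟨ ⟨ a , S j ⟩ , g · y ⟩ ∈ iter
      step h = let (a∈A , j∈ω , y∈A) = ∈Π h in
        ∈sep⁺ iterφ (∈×⁺ (∈×⁺ a∈A (S∈ω j∈ω)) (g-closed y∈A))
          (λ R closed → proj₂ closed _ _ _ (proj₂ (∈sep⁻ iterφ h) R closed))

      Origin : V → V → V → Set ℓ
      Origin a j y = (j ≡ ∅ × y ≡ a) ⊎
                     ∃[ j′ ] ∃[ y′ ] (j ≡ S j′ × y ≡ g · y′ × ⟨ ⟨ a , j′ ⟩ , y′ ⟩ ∈ iter)

      originφ : ExtFormula 3
      originφ = ∃ᵉ (∃ᵉ (∃ᵉ (v3 ≐ᵉ ⟨ ⟨ v2 , v1 ⟩ᵗ , v0 ⟩ᵗ ∧ᵉ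
        (v1 ≐ᵉ ∅ᵗ ∧ᵉ v0 ≐ᵉ v2 ∨ᵉ
         ∃ᵉ (∃ᵉ (v3 ≐ᵉ Sᵗ v1 ∧ᵉ v2 ≐ᵉ v7 ·ᵗ v0 ∧ᵉ ⟨ ⟨ v4 , v1 ⟩ᵗ , v0 ⟩ᵗ ∈ᵉ v6))))))

      origin : ∀ {a j y} → ⟨ ⟨ a , j ⟩ , y ⟩ ∈ iter → Origin a j y
      origin {a} {j} {y} h
        with ∈sep⁻ originφ (proj₂ (∈sep⁻ iterφ h) (sep originφ (iter ∷ g ∷ []) iter)
               ((λ a a∈A → ∈sep⁺ originφ (base a∈A) (a , ∅ , a , refl , inj₁ (refl , refl))) ,
                (λ a j y h → let h′ = proj₁ (∈sep⁻ originφ h) in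
                  ∈sep⁺ originφ (step h′)
                    (a , S j , g · y , refl , inj₂ (j , y , refl , refl , h′)))))
      ... | _ , _ , _ , _ , eq , o with ⟨,⟩-injective eq
      ...   | eq′ , refl with ⟨,⟩-injective eq′
      ...     | refl , refl = o

      unique : ∀ {a j y y′} → ⟨ ⟨ a , j ⟩ , y ⟩ ∈ iter → ⟨ ⟨ a , j ⟩ , y′ ⟩ ∈ iter → y ≡ y′
      unique {a} {j} {y} {y′} h h′ =
        ω-induction (∀ᵉ (∀ᵉ (∀ᵉ (⟨ ⟨ v2 , v3 ⟩ᵗ , v1 ⟩ᵗ ∈ᵉ v4 ⇒ᵉ
                                 ⟨ ⟨ v2 , v3 ⟩ᵗ , v0 ⟩ᵗ ∈ᵉ v4 ⇒ᵉ v1 ≐ᵉ v0)))) (iter ∷ [])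
          (λ a y y′ h h′ → case origin h , origin h′ of λ where
            (inj₁ (_ , e) , inj₁ (_ , e′))       → trans e (sym e′)
            (inj₂ (_ , _ , e , _) , _)           → ⊥-elim (∅≢S e)
            (inj₁ _ , inj₂ (_ , _ , e , _))      → ⊥-elim (∅≢S e))
          (λ j j∈ω ih a y y′ h h′ → case origin h , origin h′ of λ where
            (inj₁ (e , _) , _)                   → ⊥-elim (∅≢S (sym e))
            (inj₂ _ , inj₁ (e , _))              → ⊥-elim (∅≢S (sym e))
            (inj₂ (k , z , e , ey , kz) , inj₂ (k′ , z′ , e′ , ey′ , kz′)) →
              let k≡j  = S-injective j∈ω (sym e)
                  k′≡j = S-injective j∈ω (sym e′)
                  z≡z′ = ih a z z′ (subst (λ k → ⟨ ⟨ a , k ⟩ , z ⟩ ∈ iter) k≡j kz)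
                                   (subst (λ k → ⟨ ⟨ a , k ⟩ , z′ ⟩ ∈ iter) k′≡j kz′)
              in  trans ey (trans (cong (g ·_) z≡z′) (sym ey′)))
          j (proj₁ (proj₂ (∈Π h))) a y y′ h h′

      total : ∀ {a j} → a ∈ A → j ∈ ω → ∃[ y ] ⟨ ⟨ a , j ⟩ , y ⟩ ∈ iter
      total {a} {j} a∈A j∈ω =
        ω-induction (∃ᵉ (⟨ ⟨ v2 , v1 ⟩ᵗ , v0 ⟩ᵗ ∈ᵉ v3)) (a ∷ iter ∷ [])
          (a , base a∈A) (λ j _ (y , h) → g · y , step h) j j∈ω

      value : ∀ {a j y} → ⟨ ⟨ a , j ⟩ , y ⟩ ∈ iter → iter · ⟨ a , j ⟩ ≡ y
      value h = sym (·-unique (h , λ z h′ → unique h′ h))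

    abstract
      iter-∅ : ∀ {a} → a ∈ A → iter · ⟨ a , ∅ ⟩ ≡ a
      iter-∅ a∈A = value (base a∈A)

      iter-S : ∀ {a j} → a ∈ A → j ∈ ω → iter · ⟨ a , S j ⟩ ≡ g · (iter · ⟨ a , j ⟩)
      iter-S a∈A j∈ω = let (y , h) = total a∈A j∈ω in
        trans (value (step h)) (cong (g ·_) (sym (value h)))

      iter-∈ : ∀ {a j} → a ∈ A → j ∈ ω → iter · ⟨ a , j ⟩ ∈ A
      iter-∈ a∈A j∈ω = let (y , h) = total a∈A j∈ω in
        subst (_∈ A) (sym (value h)) (proj₂ (proj₂ (∈Π h)))

  -- Division with remainder by `d`

  module Division (d : V) (d∈ω : d ∈ ω) (∅∈d : ∅ ∈ d) where
    private
      A : V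
      A = ω ×ˢ d

      -- An odometer on pairs of quotient and remainder: the remainder goes up by one, and on
      -- reaching `d` it is reset while the quotient goes up. After `c` steps from `⟨ ∅ , ∅ ⟩` it
      -- shows quotient and remainder of `c`.
      stepφ : ExtFormula 4
      stepφ = ∃ᵉ (∃ᵉ (v3 ≐ᵉ ⟨ v1 , v0 ⟩ᵗ ∧ᵉ
        (Sᵗ v0 ∈ᵉ v5 ∧ᵉ v2 ≐ᵉ ⟨ v1 , Sᵗ v0 ⟩ᵗ ∨ᵉ Sᵗ v0 ≐ᵉ v5 ∧ᵉ v2 ≐ᵉ ⟨ Sᵗ v1 , ∅ᵗ ⟩ᵗ)))

      g : V
      g = function stepφ (d ∷ []) A A

      g-inner : ∀ {b r} → b ∈ ω → r ∈ d → S r ∈ d → g · ⟨ b , r ⟩ ≡ ⟨ b , S r ⟩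
      g-inner {b} {r} b∈ω r∈d Sr∈d =
        function-value stepφ (∈×⁺ b∈ω r∈d) (∈×⁺ b∈ω Sr∈d)
          (b , r , refl , inj₁ (Sr∈d , refl)) uniq
        where
        uniq : ∀ z → z ∈ A → ⟦ stepφ ⟧ (z ∷ ⟨ b , r ⟩ ∷ ⟨ ⟨ b , r ⟩ , z ⟩ ∷ d ∷ []) → z ≡ ⟨ b , S r ⟩
        uniq z _ (b′ , r′ , eq , alt) with ⟨,⟩-injective eq
        ... | refl , refl = case alt of λ where
          (inj₁ (_ , e)) → e
          (inj₂ (e , _)) → ⊥-elim (∈-irrefl (subst (_∈ d) e Sr∈d))

      g-outer : ∀ {b r} → b ∈ ω → r ∈ d → S r ≡ d → g · ⟨ b , r ⟩ ≡ ⟨ S b , ∅ ⟩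
      g-outer {b} {r} b∈ω r∈d Sr≡d =
        function-value stepφ (∈×⁺ b∈ω r∈d) (∈×⁺ (S∈ω b∈ω) ∅∈d)
          (b , r , refl , inj₂ (Sr≡d , refl)) uniq
        where
        uniq : ∀ z → z ∈ A → ⟦ stepφ ⟧ (z ∷ ⟨ b , r ⟩ ∷ ⟨ ⟨ b , r ⟩ , z ⟩ ∷ d ∷ []) → z ≡ ⟨ S b , ∅ ⟩
        uniq z _ (b′ , r′ , eq , alt) with ⟨,⟩-injective eq
        ... | refl , refl = case alt of λ where
          (inj₁ (e , _)) → ⊥-elim (∈-irrefl (subst (_∈ d) Sr≡d e))
          (inj₂ (_ , e)) → e

      g-closed : ∀ {y} → y ∈ A → g · y ∈ A
      g-closed y∈A with ∈×⁻ y∈A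
      ... | b , r , b∈ω , r∈d , refl = case S≤ d∈ω r∈d of λ where
        (inj₁ Sr∈d) → subst (_∈ A) (sym (g-inner b∈ω r∈d Sr∈d)) (∈×⁺ b∈ω Sr∈d)
        (inj₂ Sr≡d) → subst (_∈ A) (sym (g-outer b∈ω r∈d Sr≡d)) (∈×⁺ (S∈ω b∈ω) ∅∈d)

      open Iteration A g g-closed

      start : V
      start = ⟨ ∅ , ∅ ⟩

      start∈A : start ∈ A
      start∈A = ∈×⁺ ∅∈ω ∅∈d

      quotientφ remainderφ : ExtFormula 4
      quotientφ  = ∃ᵉ (v4 ·ᵗ ⟨ ⟨ ∅ᵗ , ∅ᵗ ⟩ᵗ , v2 ⟩ᵗ ≐ᵉ ⟨ v1 , v0 ⟩ᵗ)
      remainderφ = ∃ᵉ (v4 ·ᵗ ⟨ ⟨ ∅ᵗ , ∅ᵗ ⟩ᵗ , v2 ⟩ᵗ ≐ᵉ ⟨ v0 , v1 ⟩ᵗ)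

      state : V → V
      state c = iter · ⟨ start , c ⟩

    abstract
      quotient remainder : V
      quotient  = function quotientφ (iter ∷ []) ω ω
      remainder = function remainderφ (iter ∷ []) ω d

    private abstract
      state-shape : ∀ {c} → c ∈ ω → state c ≡ ⟨ quotient · c , remainder · c ⟩ ×
                                    quotient · c ∈ ω × remainder · c ∈ d
      state-shape {c} c∈ω with ∈×⁻ (iter-∈ start∈A c∈ω)
      ... | b , v , b∈ω , v∈d , eq =
        trans eq (cong₂ ⟨_,_⟩ (sym q≡b) (sym r≡v)) ,
        subst (_∈ ω) (sym q≡b) b∈ω , subst (_∈ d) (sym r≡v) v∈d
        where
        q≡b : quotient · c ≡ b
        q≡b = function-value quotientφ c∈ω b∈ω (v , eq)
          (λ z _ (_ , eq′) → proj₁ (⟨,⟩-injective (trans (sym eq′) eq)))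

        r≡v : remainder · c ≡ v
        r≡v = function-value remainderφ c∈ω v∈d (b , eq)
          (λ z _ (_ , eq′) → proj₂ (⟨,⟩-injective (trans (sym eq′) eq)))

    quotient∈ω : ∀ {c} → c ∈ ω → quotient · c ∈ ω
    quotient∈ω c∈ω = proj₁ (proj₂ (state-shape c∈ω))

    private
      state-S : ∀ {c} → c ∈ ω → state (S c) ≡ g · ⟨ quotient · c , remainder · c ⟩
      state-S c∈ω = trans (iter-S start∈A c∈ω) (cong (g ·_) (proj₁ (state-shape c∈ω)))

      quotient-≡ : ∀ {c b v} → c ∈ ω → state c ≡ ⟨ b , v ⟩ → quotient · c ≡ b × remainder · c ≡ v
      quotient-≡ c∈ω eq = ⟨,⟩-injective (trans (sym (proj₁ (state-shape c∈ω))) eq)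

      quotient-S : ∀ {c} → c ∈ ω → quotient · c ≤ quotient · (S c)
      quotient-S {c} c∈ω with state-shape c∈ω
      ... | _ , q∈ω , r∈d = case S≤ d∈ω r∈d of λ where
        (inj₁ Sr∈d) → inj₂ (sym (proj₁ (quotient-≡ (S∈ω c∈ω)
                        (trans (state-S c∈ω) (g-inner q∈ω r∈d Sr∈d)))))
        (inj₂ Sr≡d) → inj₁ (subst (quotient · c ∈_) (sym (proj₁ (quotient-≡ (S∈ω c∈ω)
                        (trans (state-S c∈ω) (g-outer q∈ω r∈d Sr≡d))))) x∈Sx)

    quotient-mono : ∀ {c e} → e ∈ ω → c ≤ e → quotient · c ≤ quotient · e
    quotient-mono e∈ω (inj₂ refl) = inj₂ refl
    quotient-mono {c} {e} e∈ω (inj₁ c∈e) =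
      ω-induction (∀ᵉ (v0 ∈ᵉ v1 ⇒ᵉ v2 ·ᵗ v0 ∈ᵉ v2 ·ᵗ v1 ∨ᵉ v2 ·ᵗ v0 ≐ᵉ v2 ·ᵗ v1)) (quotient ∷ [])
        (λ _ c∈∅ → ⊥-elim (∅-empty c∈∅))
        (λ e e∈ω ih c c∈Se → case ∈S⁻ c∈Se of λ where
          (inj₁ c∈e) → ≤-trans (quotient∈ω (S∈ω e∈ω)) (ih c c∈e) (quotient-S e∈ω)
          (inj₂ eq)  → subst (λ c → quotient · c ≤ quotient · S e) (sym eq) (quotient-S e∈ω))
        e e∈ω c c∈e

    private
      Reached : V → V → Set ℓ
      Reached b v = ∃[ c ] (c ∈ ω × state c ≡ ⟨ b , v ⟩)

      state-S′ : ∀ {c b v} → c ∈ ω → state c ≡ ⟨ b , v ⟩ → state (S c) ≡ g · ⟨ b , v ⟩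
      state-S′ c∈ω eq = trans (iter-S start∈A c∈ω) (cong (g ·_) eq)

      reach-inner : ∀ {b} → b ∈ ω → Reached b ∅ → ∀ v → v ∈ d → Reached b v
      reach-inner {b} b∈ω base v v∈d =
        ω-induction (v0 ∈ᵉ v1 ⇒ᵉ ∃ᵉ (v0 ∈ᵉ v4 ∧ᵉ v5 ·ᵗ ⟨ ⟨ ∅ᵗ , ∅ᵗ ⟩ᵗ , v0 ⟩ᵗ ≐ᵉ ⟨ v3 , v1 ⟩ᵗ))
          (d ∷ b ∷ ω ∷ iter ∷ [])
          (λ _ → base)
          (λ v v∈ω ih Sv∈d →
            let v∈d = ∈-trans d∈ω x∈Sx Sv∈d
                (c , c∈ω , eq) = ih v∈d
            in  S c , S∈ω c∈ω , trans (state-S′ c∈ω eq) (g-inner b∈ω v∈d Sv∈d))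
          v (∈ω-trans v∈d d∈ω) v∈d

      -- From `⟨ b , ∅ ⟩` the odometer runs up to `⟨ b , d′ ⟩`, with `d′` the predecessor of `d`,
      -- and its next step shows `⟨ S b , ∅ ⟩`.
      reach-zero : ∀ b → b ∈ ω → Reached b ∅
      reach-zero =
        ω-induction (∃ᵉ (v0 ∈ᵉ v2 ∧ᵉ v3 ·ᵗ ⟨ ⟨ ∅ᵗ , ∅ᵗ ⟩ᵗ , v0 ⟩ᵗ ≐ᵉ ⟨ v1 , ∅ᵗ ⟩ᵗ)) (ω ∷ iter ∷ [])
          (∅ , ∅∈ω , iter-∅ start∈A)
          (λ b b∈ω ih → case zero-or-S d∈ω of λ where
            (inj₁ eq) → ⊥-elim (∅-empty (subst (∅ ∈_) eq ∅∈d))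
            (inj₂ (d′ , _ , eq)) →
              let d′∈d = subst (d′ ∈_) (sym eq) x∈Sx
                  (c , c∈ω , eq′) = reach-inner b∈ω ih d′ d′∈d
              in  S c , S∈ω c∈ω , trans (state-S′ c∈ω eq′) (g-outer b∈ω d′∈d (sym eq)))

    abstract
      -- The odometer passes through every pair. This allows a digit to be prescribed below a given
      -- node.
      division : ∀ {b v} → b ∈ ω → v ∈ d → ∃[ c ] (c ∈ ω × quotient · c ≡ b × remainder · c ≡ v)
      division {b} {v} b∈ω v∈d =
        let (c , c∈ω , eq) = reach-inner b∈ω (reach-zero b b∈ω) v v∈d
        in  c , c∈ω , quotient-≡ c∈ω eq

  -- A point c ∈ ω is a branch of the d-ary tree: its node at height j is
  -- ⌊c / dʲ⌋, and its digit at height j is ⌊c / dʲ⌋ mod d. The points below a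
  -- given node form an interval.
  module Tree (d : V) (d∈ω : d ∈ ω) (∅∈d : ∅ ∈ d) where
    open Division d d∈ω ∅∈d
    open Iteration ω quotient quotient∈ω

    tree : V
    tree = iter

    digits : V
    digits = remainder

    node digit : V → V → V
    node c j  = tree · ⟨ c , j ⟩
    digit c j = digits · node c j

    node∈ω : ∀ {c j} → c ∈ ω → j ∈ ω → node c j ∈ ω
    node∈ω = iter-∈

    abstract
      -- Iterates monotonicity of the quotient; this is why the points below a node form an
      -- interval.
      node-mono : ∀ {c e j} → c ∈ ω → e ∈ ω → j ∈ ω → c ≤ e → node c j ≤ node e j
      node-mono {c} {e} {j} c∈ω e∈ω j∈ω c≤e =
        ω-induction (v2 ·ᵗ ⟨ v3 , v0 ⟩ᵗ ∈ᵉ v2 ·ᵗ ⟨ v4 , v0 ⟩ᵗ ∨ᵉ v2 ·ᵗ ⟨ v3 , v0 ⟩ᵗ ≐ᵉ v2 ·ᵗ ⟨ v4 , v0 ⟩ᵗ)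
          (ω ∷ tree ∷ c ∷ e ∷ [])
          (subst₂ _≤_ (sym (iter-∅ c∈ω)) (sym (iter-∅ e∈ω)) c≤e)
          (λ j j∈ω ih → subst₂ _≤_ (sym (iter-S c∈ω j∈ω)) (sym (iter-S e∈ω j∈ω))
                          (quotient-mono (node∈ω e∈ω j∈ω) ih))
          j j∈ω

      -- Descends from `y` one level at a time, with digit `∅` at each level.
      node-surjective : ∀ {j y} → j ∈ ω → y ∈ ω → ∃[ c ] (c ∈ ω × node c j ≡ y)
      node-surjective {j} {y} j∈ω y∈ω =
        ω-induction (∀ᵉ (v0 ∈ᵉ v2 ⇒ᵉ ∃ᵉ (v0 ∈ᵉ v3 ∧ᵉ v4 ·ᵗ ⟨ v0 , v2 ⟩ᵗ ≐ᵉ v1))) (ω ∷ tree ∷ [])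
          (λ y y∈ω → y , y∈ω , iter-∅ y∈ω)
          (λ j j∈ω ih y y∈ω →
            let (z , z∈ω , qz≡y , _) = division y∈ω ∅∈d
                (c , c∈ω , eq) = ih z z∈ω
            in  c , c∈ω , trans (iter-S c∈ω j∈ω) (trans (cong (quotient ·_) eq) qz≡y))
          j j∈ω y y∈ω

      node-above : ∀ {c c′ i j} → c ∈ ω → c′ ∈ ω → i ∈ ω → node c j ≡ node c′ j → j ≤ i →
                   node c i ≡ node c′ i
      node-above c∈ω c′∈ω i∈ω eq (inj₂ refl) = eq
      node-above {c} {c′} {i} {j} c∈ω c′∈ω i∈ω eq (inj₁ j∈i) =
        ω-induction (v1 ∈ᵉ v0 ⇒ᵉ v2 ·ᵗ ⟨ v3 , v0 ⟩ᵗ ≐ᵉ v2 ·ᵗ ⟨ v4 , v0 ⟩ᵗ) (j ∷ tree ∷ c ∷ c′ ∷ [])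
          (λ j∈∅ → ⊥-elim (∅-empty j∈∅))
          (λ i i∈ω ih j∈Si → trans (iter-S c∈ω i∈ω) (trans
            (cong (quotient ·_) (case ∈S⁻ j∈Si of λ where
              (inj₁ j∈i)  → ih j∈i
              (inj₂ refl) → eq))
            (sym (iter-S c′∈ω i∈ω))))
          i i∈ω j∈i

      -- `division` provides a node at height `i` with parent `node c (S i)` and digit `v`, and some
      -- point lies below that node.
      extend : ∀ {c i v} → c ∈ ω → i ∈ ω → v ∈ d →
               ∃[ c′ ] (c′ ∈ ω × node c′ (S i) ≡ node c (S i) × digit c′ i ≡ v)
      extend {c} {i} c∈ω i∈ω v∈d =
        let (z , z∈ω , qz≡ , rz≡) = division (node∈ω c∈ω (S∈ω i∈ω)) v∈d
            (c′ , c′∈ω , eq) = node-surjective i∈ω z∈ω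
        in  c′ , c′∈ω , trans (iter-S c′∈ω i∈ω) (trans (cong (quotient ·_) eq) qz≡) ,
            trans (cong (digits ·_) eq) rz≡

-- Filling gaps and amalgamating branches

module Saturation
  (em : ∀ {a} → ExcludedMiddle a) (ext : ∀ {a b} → Extensionality a b)
  {ℓ : Level} (𝕍 : Structure ℓ) (zfc : IsModelOfZFC⁻ 𝕍)
  (ω : Structure.Carrier 𝕍) (isOmega : IsOmega 𝕍 ω)
  (nonstandard : IsNonstandardOmega 𝕍 ω)
  (𝔭 : Cardinal ℓ) (is𝔭 : Is𝔭 𝕍 ω 𝔭)
  (Λ : Cardinal ℓ) (Λ<𝔭 : Λ <ᶜ 𝔭)
  (fresh : (s : List (Cardinal.Carrier Λ)) → ∃[ x ] x ∉ₗ s)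
  where

  open Structure 𝕍 renaming (Carrier to V)
  open Classical em
  open WellOrder Λ
  open Infinite fresh
  open Model em 𝕍 zfc
  open Omega em 𝕍 zfc ω isOmega

  i₀ : I
  i₀ = proj₁ (fresh [])

  open FreshSequence i₀ fresh using (seq; seq-injective)

  -- A surjection onto the external naturals; it lets all numerals enter as lower bounds in a family
  -- indexed by `I`.
  rank : I → ℕ
  rank = preimage seq 0

  rank-surjective : ∀ k → ∃[ γ ] rank γ ≡ k
  rank-surjective k = seq k , seq-injective (preimage-correct seq 0 k)

  infinitelyLarge : V → Set ℓ
  infinitelyLarge j = ∀ k → numeral k ∈ j

  -- An element of `ω` that is no numeral lies above every numeral, because only numerals lie at or
  -- below a numeral.
  ∃-infinitelyLarge : ∃[ N ] (N ∈ ω × infinitelyLarge N)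
  ∃-infinitelyLarge with ¬∀⇒∃¬ nonstandard
  ... | N , ¬numeral = N , N∈ω , λ k → case ∈-or-≥ (numeral∈ω k) N∈ω of λ where
      (inj₁ k∈N) → k∈N
      (inj₂ N≤k) → let (j , eq) = ≤numeral k N≤k in
        ⊥-elim (¬numeral λ _ → j , subst (IsNumeral 𝕍 j) (sym eq) (numeral-isNumeral j))
    where
    N∈ω : N ∈ ω
    N∈ω = case em of λ where
      (yes N∈ω) → N∈ω
      (no N∉ω)  → ⊥-elim (¬numeral λ N∈ω → ⊥-elim (N∉ω N∈ω))

  -- Weak on the left and strict on the right, so that a maximum of `a`, or the predecessor of a
  -- minimum of `b`, qualifies.
  Filled : (a b : I → V) → Set ℓ
  Filled a b = ∃[ c ] (c ∈ ω × (∀ i → a i ≤ c) × (∀ j → c ∈ b j))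

  abstract
    -- If `a` has no maximum and `b` no minimum, cofinal sequences of regular lengths κ and θ can be
    -- extracted from them. An unfilled gap would then be a cut, so `𝔭` would inject into the sum of
    -- κ and θ, which embeds into two copies of `I` and by `double` into `I`, against `Λ <ᶜ 𝔭`.
    fill-gap : (a b : I → V) → (∀ i → a i ∈ ω) → (∀ j → b j ∈ ω) →
               (∀ i j → a i ∈ b j) → Filled a b
    fill-gap a b a∈ω b∈ω a<b
      with em {P = ∃[ i ] (∀ j → a j ≤ a i)} | em {P = ∃[ j ] (∀ i → b j ≤ b i)}
    ... | yes (i , max) | _ = a i , a∈ω i , max , a<b i
    ... | no _ | yes (j , min) with zero-or-S (b∈ω j)
    ...   | inj₁ b≡∅ = ⊥-elim (∅-empty (subst (a i₀ ∈_) b≡∅ (a<b i₀ j)))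
    ...   | inj₂ (y , y∈ω , b≡Sy) =
      y , y∈ω , (λ i → ∈S⁻ (subst (a i ∈_) b≡Sy (a<b i j))) ,
      λ i → ∈-≤-trans (b∈ω i) (subst (y ∈_) (sym b≡Sy) x∈Sx) (min i)
    fill-gap a b a∈ω b∈ω a<b | no ∄max | no ∄min with em {P = Filled a b}
    ... | yes filled = filled
    ... | no ¬filled = ⊥-elim (proj₂ Λ<𝔭 𝔭↣Λ)
      where
      L : Set ℓ
      L = ElementsOf 𝕍 ω

      _≺_ : Rel L ℓ
      _≺_ = _<̂_ 𝕍 {ω}

      noMax : ∀ i → ∃[ j ] a i ∈ a j
      noMax i = case ¬∀⇒∃¬ (λ max → ∄max (i , max)) of λ where
        (j , a≰) → case ∈-or-≥ (a∈ω i) (a∈ω j) of λ where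
          (inj₁ lt) → j , lt
          (inj₂ le) → ⊥-elim (a≰ le)

      noMin : ∀ j → ∃[ i ] b i ∈ b j
      noMin j = case ¬∀⇒∃¬ (λ min → ∄min (j , min)) of λ where
        (i , b≰) → case ∈-or-≥ (b∈ω i) (b∈ω j) of λ where
          (inj₁ lt) → i , lt
          (inj₂ le) → ⊥-elim (b≰ le)

      ≺-cotrans : ∀ {x z : L} (y : L) → x ≺ z → x ≺ y ⊎ y ≺ z
      ≺-cotrans {x , x∈ω} {z , z∈ω} (y , y∈ω) x∈z = case ∈-or-≥ x∈ω y∈ω of λ where
        (inj₁ x∈y) → inj₁ x∈y
        (inj₂ y≤x) → inj₂ (≤-∈-trans z∈ω y≤x x∈z)

      irrefl : ∀ {x} → ¬ (x ≺ x)
      irrefl {x} = ∈-irrefl {proj₁ x}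

      ≺-trans : ∀ {x y z} → x ≺ y → y ≺ z → x ≺ z
      ≺-trans {x} {y} {z} = ∈-trans {proj₁ x} {proj₁ y} {proj₁ z} (proj₂ z)

      ≻-trans : ∀ {x y z} → y ≺ x → z ≺ y → z ≺ x
      ≻-trans {x} {y} {z} y≺x z≺y = ≺-trans {z} {y} {x} z≺y y≺x

      ≻-cotrans : ∀ {x z} (y : L) → z ≺ x → y ≺ x ⊎ z ≺ y
      ≻-cotrans {x} {z} y z≺x = Sum.swap (≺-cotrans {z} {x} y z≺x)

      module Lower = Cofinality ext _≺_
        (λ {x} → irrefl {x}) (λ {x} {y} {z} → ≺-trans {x} {y} {z})
        (λ {x} {z} → ≺-cotrans {x} {z}) i₀ (λ i → a i , a∈ω i) noMax

      module Upper = Cofinality ext (flip _≺_)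
        (λ {x} → irrefl {x}) (λ {x} {y} {z} → ≻-trans {x} {y} {z})
        (λ {x} {z} → ≻-cotrans {x} {z}) i₀ (λ j → b j , b∈ω j) noMin

      cut : Cut Lower.κ Upper.κ _≺_
      cut = record
        { a = Lower.b
        ; b = Upper.b
        ; increasing = Lower.b-mono
        ; decreasing = Upper.b-mono
        ; below = λ _ _ → a<b _ _
        ; unfilled = λ (c , c∈ω) fills → ¬filled (c , c∈ω ,
            (λ i → let (α , lt) = Lower.b-cofinal i in
              inj₁ (∈-trans c∈ω lt (proj₁ (fills α (proj₁ (Upper.b-cofinal i₀)))))) ,
            (λ j → let (β , lt) = Upper.b-cofinal j in
              ∈-trans (b∈ω j) (proj₂ (fills (proj₁ (Lower.b-cofinal i₀)) β)) lt))
        }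

      𝔭↣Λ : Cardinal.Carrier 𝔭 ↣ I
      𝔭↣Λ = mk↣ {to = double} double-injective
        ↣-∘ ((Lower.κ↣Λ ⊎-↣ Upper.κ↣Λ)
        ↣-∘ IsLeastCut.minimal is𝔭 Lower.κ Upper.κ Lower.regular Upper.regular cut)

  module _ (d : V) (d∈ω : d ∈ ω) (∅∈d : ∅ ∈ d) where
    open Tree d d∈ω ∅∈d

    -- (c , j) stands for the node of c at height j.
    Position : V × V → Set ℓ
    Position (c , j) = c ∈ ω × j ∈ ω × infinitelyLarge j

    DigitsFrom : V → V → V → V → Set ℓ
    DigitsFrom A c i j = ∀ k → i ≤ k → k ∈ j → digit c k ∈ A

    -- The relation of a limit position to the earlier ones; in contrast to `Extends`, the heights
    -- may coincide.
    Bounds : V → V × V → V × V → Set ℓ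
    Bounds A (cγ , jγ) (c , j) = j ≤ jγ × node c jγ ≡ node cγ jγ × DigitsFrom A c j jγ

    Amalgam : (P : I → Set ℓ) (A : I → V) (F : I → V × V) → Set ℓ
    Amalgam P A F = ∃[ s ] (Position s × (∀ γ → P γ → Bounds (A γ) (F γ) s))

    private
      -- The least solutions are the two ends of the interval of points below a node, the right end
      -- excluded.
      leftφ rightφ : ExtFormula 4
      leftφ  = v1 ·ᵗ ⟨ v0 , v2 ⟩ᵗ ≐ᵉ v3
      rightφ = v3 ∈ᵉ v1 ·ᵗ ⟨ v0 , v2 ⟩ᵗ

      digitsφ : ExtFormula 7
      digitsφ = (v1 ∈ᵉ v0 ∨ᵉ v1 ≐ᵉ v0) ∧ᵉ
        ∀ᵉ ((v1 ∈ᵉ v0 ∨ᵉ v1 ≐ᵉ v0) ⇒ᵉ v0 ∈ᵉ v3 ⇒ᵉ v5 ·ᵗ (v6 ·ᵗ ⟨ v7 , v0 ⟩ᵗ) ∈ᵉ v4)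

    abstract
      -- Two applications of `fill-gap`: between the ends of the intervals for the point `c`, then
      -- between the heights `a γ` and `S (J δ)` for the height `j`.
      amalgamate-all : (A : I → V) (F : I → V × V) → (∀ γ → Position (F γ)) →
        (∀ γ δ → let (cγ , jγ) = F γ ; (cδ , jδ) = F δ in
          jγ ≤ jδ → node cγ jδ ≡ node cδ jδ) →
        (∀ γ δ → let (cγ , jγ) = F γ ; (cδ , jδ) = F δ in DigitsFrom (A γ) cδ jδ jγ) →
        Amalgam (λ _ → ⊤) A F
      amalgamate-all A F pos agree digs =
        (c , j) , (c∈ω , j∈ω , j-large) , λ γ _ → j≤ γ , node-c γ , digits-c γ
        where
        C J : I → V
        C = proj₁ ∘ F
        J = proj₂ ∘ F

        C∈ω : ∀ γ → C γ ∈ ω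
        C∈ω γ = proj₁ (pos γ)

        J∈ω : ∀ γ → J γ ∈ ω
        J∈ω γ = proj₁ (proj₂ (pos γ))

        left : ∀ γ → ∃[ l ] (l ∈ ω × node l (J γ) ≡ node (C γ) (J γ) ×
          (∀ e → e ∈ ω → node e (J γ) ≡ node (C γ) (J γ) → l ≤ e))
        left γ = ω-least leftφ (tree ∷ J γ ∷ node (C γ) (J γ) ∷ []) (C∈ω γ) refl

        right : ∀ γ → ∃[ u ] (u ∈ ω × node (C γ) (J γ) ∈ node u (J γ) ×
          (∀ e → e ∈ ω → node (C γ) (J γ) ∈ node e (J γ) → u ≤ e))
        right γ =
          -- The successor of the node is also a node at this height, so points to the right of the
          -- interval exist.
          let (e , e∈ω , eq) = node-surjective (J∈ω γ) (S∈ω (node∈ω (C∈ω γ) (J∈ω γ)))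
          in  ω-least rightφ (tree ∷ J γ ∷ node (C γ) (J γ) ∷ []) e∈ω
                (subst (node (C γ) (J γ) ∈_) (sym eq) x∈Sx)

        l u : I → V
        l = proj₁ ∘ left
        u = proj₁ ∘ right

        l∈ω : ∀ γ → l γ ∈ ω
        l∈ω γ = proj₁ (proj₂ (left γ))

        u∈ω : ∀ γ → u γ ∈ ω
        u∈ω γ = proj₁ (proj₂ (right γ))

        before-right : ∀ {e} δ → e ∈ ω → node e (J δ) ≡ node (C δ) (J δ) → e ∈ u δ
        before-right {e} δ e∈ω eq = case ∈-or-≥ e∈ω (u∈ω δ) of λ where
          (inj₁ e∈u) → e∈u
          (inj₂ u≤e) → ⊥-elim (≤⇒∌ (node∈ω (u∈ω δ) (J∈ω δ))
            (node-mono (u∈ω δ) e∈ω (J∈ω δ) u≤e)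
            (subst (_∈ node (u δ) (J δ)) (sym eq) (proj₁ (proj₂ (proj₂ (right δ))))))

        common : ∀ γ δ e → e ∈ ω → node e (J γ) ≡ node (C γ) (J γ) →
                 node e (J δ) ≡ node (C δ) (J δ) → l γ ∈ u δ
        common γ δ e e∈ω eqγ eqδ =
          ≤-∈-trans (u∈ω δ) (proj₂ (proj₂ (proj₂ (left γ))) e e∈ω eqγ) (before-right δ e∈ω eqδ)

        -- Any two intervals meet: of the two points `C γ` and `C δ`, one at the smaller height lies
        -- below both nodes.
        l<u : ∀ γ δ → l γ ∈ u δ
        l<u γ δ = case ∈-or-≥ (J∈ω γ) (J∈ω δ) of λ where
          (inj₁ lt) → common γ δ (C γ) (C∈ω γ) refl (agree γ δ (inj₁ lt))
          (inj₂ le) → common γ δ (C δ) (C∈ω δ) (agree δ γ le) refl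

        filled-c : Filled l u
        filled-c = fill-gap l u l∈ω u∈ω l<u

        c : V
        c = proj₁ filled-c

        c∈ω : c ∈ ω
        c∈ω = proj₁ (proj₂ filled-c)

        node-c : ∀ γ → node c (J γ) ≡ node (C γ) (J γ)
        node-c γ = sym (≤-antisym (node∈ω (C∈ω γ) (J∈ω γ)) lower upper)
          where
          lower : node (C γ) (J γ) ≤ node c (J γ)
          lower = subst (_≤ node c (J γ)) (proj₁ (proj₂ (proj₂ (left γ))))
            (node-mono (l∈ω γ) c∈ω (J∈ω γ) (proj₁ (proj₂ (proj₂ filled-c)) γ))

          upper : node c (J γ) ≤ node (C γ) (J γ)
          upper = case ∈-or-≥ (node∈ω (C∈ω γ) (J∈ω γ)) (node∈ω c∈ω (J∈ω γ)) of λ where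
            (inj₁ lt) → ⊥-elim (≤⇒∌ (u∈ω γ) (proj₂ (proj₂ (proj₂ (right γ))) c c∈ω lt)
                                  (proj₂ (proj₂ (proj₂ filled-c)) γ))
            (inj₂ le) → le

        digits-at-J : ∀ γ δ → DigitsFrom (A γ) c (J δ) (J γ)
        digits-at-J γ δ k Jδ≤k k∈Jγ =
          subst (λ x → digits · x ∈ A γ)
            (sym (node-above c∈ω (C∈ω δ) (∈ω-trans k∈Jγ (J∈ω γ)) (node-c δ) Jδ≤k))
            (digs γ δ k Jδ≤k k∈Jγ)

        params : I → Vec V 6
        params γ = numeral (rank γ) ∷ J γ ∷ A γ ∷ digits ∷ tree ∷ c ∷ []

        -- How far down from `J γ` the digits of `c` stay in `A γ`. The bound by `numeral (rank γ)`
        -- forces the height found later above every numeral.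
        lowest : ∀ γ → ∃[ a ] (a ∈ ω × (numeral (rank γ) ≤ a × DigitsFrom (A γ) c a (J γ)) ×
          (∀ y → y ∈ ω → numeral (rank γ) ≤ y × DigitsFrom (A γ) c y (J γ) → a ≤ y))
        lowest γ = ω-least digitsφ (params γ) (J∈ω γ)
          (inj₁ (proj₂ (proj₂ (pos γ)) (rank γ)) , digits-at-J γ γ)

        a : I → V
        a = proj₁ ∘ lowest

        a∈ω : ∀ γ → a γ ∈ ω
        a∈ω γ = proj₁ (proj₂ (lowest γ))

        filled-j : Filled a (S ∘ J)
        -- Each `J δ` satisfies the condition whose least solution is `a γ`. The successor turns the
        -- strict upper bound of `fill-gap` into `j ≤ J δ`.
        filled-j = fill-gap a (S ∘ J) a∈ω (S∈ω ∘ J∈ω) λ γ δ →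
          ≤⇒∈S (proj₂ (proj₂ (proj₂ (lowest γ))) (J δ) (J∈ω δ)
                 (inj₁ (proj₂ (proj₂ (pos δ)) (rank γ)) , digits-at-J γ δ))

        j : V
        j = proj₁ filled-j

        j∈ω : j ∈ ω
        j∈ω = proj₁ (proj₂ filled-j)

        a≤j : ∀ γ → a γ ≤ j
        a≤j = proj₁ (proj₂ (proj₂ filled-j))

        j≤ : ∀ γ → j ≤ J γ
        j≤ γ = ∈S⁻ (proj₂ (proj₂ (proj₂ filled-j)) γ)

        j-large : infinitelyLarge j
        j-large k =
          -- `suc k` makes up for the weak bound: `numeral k` must lie strictly below `j`.
          let (γ , eq) = rank-surjective (suc k)
              k≤a = subst (λ m → numeral m ≤ a γ) eq (proj₁ (proj₁ (proj₂ (proj₂ (lowest γ)))))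
          in  ∈-≤-trans j∈ω x∈Sx (≤-trans j∈ω k≤a (a≤j γ))

        digits-c : ∀ γ → DigitsFrom (A γ) c j (J γ)
        digits-c γ k j≤k k∈J = proj₂ (proj₁ (proj₂ (proj₂ (lowest γ)))) k
          (≤-trans (∈ω-trans k∈J (J∈ω γ)) (a≤j γ) j≤k) k∈J

    -- Chains of positions

    Extends : V → V × V → V × V → Set ℓ
    Extends A (c , j) (c′ , j′) = j′ ∈ j × node c′ j ≡ node c j × DigitsFrom A c′ j′ j

    abstract
      -- `amalgamate-all` takes families over all of `I`; outside `P` the index `γ₀` is repeated.
      reindex : (P : I → Set ℓ) → ∃ P →
                Σ[ r ∈ (I → I) ] ((∀ γ → P (r γ)) × (∀ γ → P γ → r γ ≡ γ))
      reindex P (γ₀ , Pγ₀) = r , P-r , r-P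
        where
        r : I → I
        r γ with em {P = P γ}
        ... | yes _ = γ
        ... | no _  = γ₀

        P-r : ∀ γ → P (r γ)
        P-r γ with em {P = P γ}
        ... | yes Pγ = Pγ
        ... | no _   = Pγ₀

        r-P : ∀ γ → P γ → r γ ≡ γ
        r-P γ Pγ with em {P = P γ}
        ... | yes _  = refl
        ... | no ¬Pγ = ⊥-elim (¬Pγ Pγ)

    IsChain : (P : I → Set ℓ) (A : I → V) (F : I → V × V) → Set ℓ
    IsChain P A F = (∀ γ → P γ → Position (F γ)) ×
                    (∀ γ δ → γ < δ → P γ → P δ → Extends (A γ) (F γ) (F δ))

    abstract
      -- Heights strictly decrease along the chain, so `jγ ≤ jδ` excludes `γ < δ`.
      chain-agree : ∀ {P A F} → IsChain P A F → ∀ γ δ → P γ → P δ →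
        let (cγ , jγ) = F γ ; (cδ , jδ) = F δ in jγ ≤ jδ → node cγ jδ ≡ node cδ jδ
      chain-agree {F = F} (pos , ext) γ δ Pγ Pδ le = case compare γ δ of λ where
        (tri< lt _ _) → ⊥-elim (≤⇒∌ (proj₁ (proj₂ (pos γ Pγ))) le (proj₁ (ext γ δ lt Pγ Pδ)))
        (tri≈ _ eq _) → cong (λ x → node (proj₁ (F x)) (proj₂ (F δ))) eq
        (tri> _ _ gt) → proj₁ (proj₂ (ext δ γ gt Pδ Pγ))

      -- Unless `γ < δ`, no height `k` satisfies `jδ ≤ k` and `k ∈ jγ`.
      chain-digits : ∀ {P A F} → IsChain P A F → ∀ γ δ → P γ → P δ →
        let (cγ , jγ) = F γ ; (cδ , jδ) = F δ in DigitsFrom (A γ) cδ jδ jγ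
      chain-digits {F = F} (pos , ext) γ δ Pγ Pδ k jδ≤k k∈jγ = case compare γ δ of λ where
          (tri< lt _ _) → proj₂ (proj₂ (ext γ δ lt Pγ Pδ)) k jδ≤k k∈jγ
          (tri≈ _ eq _) → ⊥-elim (≤⇒∌ (proj₁ (proj₂ (pos δ Pδ))) jδ≤k
                                    (subst (λ x → k ∈ proj₂ (F x)) eq k∈jγ))
          (tri> _ _ gt) → ⊥-elim (∈-asym jγ∈ω (proj₁ (ext δ γ gt Pδ Pγ))
                                            (≤-∈-trans jγ∈ω jδ≤k k∈jγ))
        where
        jγ∈ω : proj₂ (F γ) ∈ ω
        jγ∈ω = proj₁ (proj₂ (pos γ Pγ))

      amalgam-reindex : ∀ {P A F} (r : I → I) → (∀ γ → P γ → r γ ≡ γ) →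
                        Amalgam (λ _ → ⊤) (A ∘ r) (F ∘ r) → Amalgam P A F
      amalgam-reindex {P} {A} {F} r r-P (s , pos-s , h) =
        s , pos-s , λ γ Pγ → subst (λ γ → Bounds (A γ) (F γ) s) (r-P γ Pγ) (h γ tt)

      amalgamate-inhabited : ∀ {P A F} → IsChain P A F →
        (r : I → I) → (∀ γ → P (r γ)) → Amalgam (λ _ → ⊤) (A ∘ r) (F ∘ r)
      amalgamate-inhabited {P} {A} {F} chain r P-r = amalgamate-all (A ∘ r) (F ∘ r)
        (λ γ → proj₁ chain (r γ) (P-r γ))
        (λ γ δ → chain-agree {P} {A} {F} chain (r γ) (r δ) (P-r γ) (P-r δ))
        (λ γ δ → chain-digits {P} {A} {F} chain (r γ) (r δ) (P-r γ) (P-r δ))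

      -- The start of a chain: any infinitely large height will do.
      amalgam-empty : ∀ {P A F} → ¬ ∃ P → Amalgam P A F
      amalgam-empty ∄P = let (N , N∈ω , large) = ∃-infinitelyLarge in
        (∅ , N) , (∅∈ω , N∈ω , large) , λ γ Pγ → ⊥-elim (∄P (γ , Pγ))

      amalgamate : ∀ P A F → IsChain P A F → Amalgam P A F
      amalgamate P A F chain = case em {P = ∃ P} of λ where
        (no ∄P)  → amalgam-empty {P} {A} {F} ∄P
        (yes ∃P) → let (r , P-r , r-P) = reindex P ∃P in
          amalgam-reindex {P} {A} {F} r r-P (amalgamate-inhabited {P} {A} {F} chain r P-r)

    bounds⇒extends : ∀ {A c c′ i} p → c ∈ ω → c′ ∈ ω →
      node c′ (S i) ≡ node c (S i) → digit c′ i ∈ A →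
      Position p → Bounds A p (c , S i) → Extends A p (c′ , i)
    bounds⇒extends {A} {c} {c′} {i} (cγ , jγ) c∈ω c′∈ω node≡ digit∈A
                   (cγ∈ω , jγ∈ω , _) (Si≤jγ , node-c , digits-c) =
      ∈-≤-trans jγ∈ω x∈Sx Si≤jγ ,
      trans (node-above c′∈ω c∈ω jγ∈ω node≡ Si≤jγ) node-c ,
      digits-c′
      where
      digits-c′ : DigitsFrom A c′ i jγ
      digits-c′ k (inj₂ i≡k) _    = subst (λ k → digit c′ k ∈ A) i≡k digit∈A
      digits-c′ k (inj₁ i∈k) k∈jγ =
        let k∈ω  = ∈ω-trans k∈jγ jγ∈ω
            Si≤k = S≤ k∈ω i∈k
        in  subst (λ x → digits · x ∈ A) (sym (node-above c′∈ω c∈ω k∈ω node≡ Si≤k))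
              (digits-c k Si≤k k∈jγ)

    abstract
      -- Goes one level below the amalgam and puts the digit `v` there, which makes the heights
      -- strictly decrease. An infinitely large `j` has a predecessor, and this is again infinitely
      -- large.
      append : ∀ P A F → Amalgam P A F → ∀ {v} → v ∈ d → (∀ γ → P γ → v ∈ A γ) →
               ∃[ s ] (Position s × (∀ γ → P γ → Position (F γ) → Extends (A γ) (F γ) s))
      append P A F ((c , j) , (c∈ω , j∈ω , j-large) , h) {v} v∈d v∈A =
        case zero-or-S j∈ω of λ where
          (inj₁ j≡∅) → ⊥-elim (∅-empty (subst (∅ ∈_) j≡∅ (j-large 0)))
          (inj₂ (i , i∈ω , j≡Si)) →
            let (c′ , c′∈ω , node≡ , digit≡) = extend c∈ω i∈ω v∈d
            in  (c′ , i) ,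
                (c′∈ω , i∈ω , λ k → ∈-≤-trans i∈ω x∈Sx
                   (∈S⁻ (subst (numeral (suc k) ∈_) j≡Si (j-large (suc k))))) ,
                λ γ Pγ pos → bounds⇒extends (F γ) c∈ω c′∈ω node≡
                  (subst (_∈ A γ) (sym digit≡) (v∈A γ Pγ)) pos
                  (subst (λ j → Bounds (A γ) (F γ) (c , j)) j≡Si (h γ Pγ))

    Approximated : (P : I → Set ℓ) (A : I → V) → Set ℓ
    Approximated P A =
      ∀ α → P α → ∃[ v ] (v ∈ d × (∀ γ → P γ → γ < α ⊎ γ ≡ α → v ∈ A γ))

    abstract
      -- The successor and limit stages are treated alike: amalgamate the earlier positions, then
      -- append the point approximating at `α`. The recursion runs over all of `I`, hence the guards
      -- and the arbitrary position outside `P`.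
      chain-next : ∀ {P A} → Approximated P A → ∀ α (F : I → V × V) →
        (∀ γ → γ < α → P γ → Position (F γ)) →
        (∀ γ δ → γ < δ → δ < α → P γ → P δ → Extends (A γ) (F γ) (F δ)) →
        ∃[ s ] ((P α → Position s) × (∀ γ → γ < α → P γ → P α → Extends (A γ) (F γ) s))
      chain-next {P} {A} approx α F pos ext = case em {P = P α} of λ where
        (no ¬Pα) → (∅ , ∅) , (⊥-elim ∘ ¬Pα) , λ _ _ _ → ⊥-elim ∘ ¬Pα
        (yes Pα) →
          let (v , v∈d , v∈A) = approx α Pα
              (s , pos-s , extends) = append (λ γ → P γ × γ < α) A F
                (amalgamate (λ γ → P γ × γ < α) A F
                  ((λ γ (Pγ , γ<α) → pos γ γ<α Pγ) ,
                   (λ γ δ γ<δ (Pγ , _) (Pδ , δ<α) → ext γ δ γ<δ δ<α Pγ Pδ)))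
                v∈d (λ γ (Pγ , γ<α) → v∈A γ Pγ (inj₁ γ<α))
          in  s , (λ _ → pos-s) , λ γ γ<α Pγ _ → extends γ (Pγ , γ<α) (pos γ γ<α Pγ)

      ∃-chain : ∀ {P A} → Approximated P A → ∃ (IsChain P A)
      ∃-chain {P} {A} approx = dependentChoice ext wellFounded (∅ , ∅)
        (λ α s → P α → Position s) (λ γ s δ t → P γ → P δ → Extends (A γ) s t)
        (chain-next {P} {A} approx)

      -- Let `(c , j)` amalgamate the whole chain. Each `γ` has a later `δ` in `P`, so `j ≤ jδ` and
      -- `jδ ∈ jγ`; thus `j` lies strictly below `jγ`, where the digits of `c` are controlled by
      -- `A γ`.
      realize-unbounded : ∀ P A → (∀ α → P α → ∃[ β ] (P β × α < β)) →
                          Approximated P A → ∃[ v ] (∀ γ → P γ → v ∈ A γ)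
      realize-unbounded P A noMax approx =
        let (F , chain@(pos , ext)) = ∃-chain {P} {A} approx
            ((c , j) , _ , h) = amalgamate P A F chain
        in  digit c j , λ γ Pγ →
              let (δ , Pδ , γ<δ) = noMax γ Pγ
                  jδ∈jγ = proj₁ (ext γ δ γ<δ Pγ Pδ)
                  jγ∈ω  = proj₁ (proj₂ (pos γ Pγ))
              in  proj₂ (proj₂ (h γ Pγ)) j (inj₂ refl) (≤-∈-trans jγ∈ω (proj₁ (h δ Pδ)) jδ∈jγ)

    -- Induction on initial segments

    private
      memberφ : ExtFormula 2
      memberφ = v0 ∈ᵉ v1

    infixl 7 _∩_
    _∩_ : V → V → V
    B ∩ A = sep memberφ (A ∷ []) B

    module _ (A : I → V) where

      FIP : V → Set ℓ
      FIP B = (s : List I) → ∃[ v ] (v ∈ B × All (λ α → v ∈ A α) s)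

      -- The quantification over `B` lets the induction absorb one of the sets `A α` into `B`.
      Meets : (I → Set ℓ) → Set ℓ
      Meets P = ∀ B → (∀ v → v ∈ B → v ∈ d) → FIP B → ∃[ v ] (v ∈ B × (∀ α → P α → v ∈ A α))

      meets : (P : I → Set ℓ) → (∀ α → P α → Meets (_< α)) → Meets P
      meets P below B B⊆d fip = case em {P = ∃ P} of λ where
          (no ∄P) → let (v , v∈B , _) = fip [] in v , v∈B , λ α Pα → ⊥-elim (∄P (α , Pα))
          (yes ∃P) → case em {P = ∃[ α ] (P α × ¬ (∃[ γ ] (P γ × α < γ)))} of λ where
            (yes (α , Pα , max)) → with-maximum α Pα max
            (no ∄max)            → without-maximum ∃P ∄max
        where
        -- Replacing `B` by `B ∩ A α` leaves only the indices below `α`; the intersection property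
        -- survives because `α` can be added to each finite list.
        approx : ∀ α → P α → ∃[ v ] (v ∈ B × (∀ γ → γ < α ⊎ γ ≡ α → v ∈ A γ))
        approx α Pα =
          let (v , v∈ , v∈A) = below α Pα (B ∩ A α)
                (λ v v∈ → B⊆d v (proj₁ (∈sep⁻ memberφ v∈)))
                (λ s → let (v , v∈B , v∈s) = fip (α ∷ s) in
                  v , ∈sep⁺ memberφ v∈B (All.head v∈s) , All.tail v∈s)
          in  v , proj₁ (∈sep⁻ memberφ v∈) , λ γ → λ where
                (inj₁ γ<α)  → v∈A γ γ<α
                (inj₂ refl) → proj₂ (∈sep⁻ memberφ v∈)

        with-maximum : ∀ α → P α → ¬ (∃[ γ ] (P γ × α < γ)) →
                       ∃[ v ] (v ∈ B × (∀ γ → P γ → v ∈ A γ))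
        with-maximum α Pα max =
          let (v , v∈B , v∈A) = approx α Pα in
          v , v∈B , λ γ Pγ → v∈A γ (case compare γ α of λ where
            (tri< lt _ _) → inj₁ lt
            (tri≈ _ eq _) → inj₂ eq
            (tri> _ _ gt) → ⊥-elim (max (γ , Pγ , gt)))

        without-maximum : ∃ P → ¬ (∃[ α ] (P α × ¬ (∃[ γ ] (P γ × α < γ)))) →
                          ∃[ v ] (v ∈ B × (∀ γ → P γ → v ∈ A γ))
        without-maximum (α , Pα) ∄max =
          -- Intersecting with `B` ensures that the point found lies in `B`.
          let (v , h) = realize-unbounded P (λ α → B ∩ A α)
                (λ α Pα → case em {P = ∃[ γ ] (P γ × α < γ)} of λ where
                  (yes above) → above
                  (no ∄above) → ⊥-elim (∄max (α , Pα , ∄above)))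
                (λ α Pα → let (v , v∈B , v∈A) = approx α Pα in
                  v , B⊆d v v∈B , λ γ _ le → ∈sep⁺ memberφ v∈B (v∈A γ le))
          in  v , proj₁ (∈sep⁻ memberφ (h α Pα)) , λ γ Pγ → proj₂ (∈sep⁻ memberφ (h γ Pγ))

      FIP⇒meets-below : ∀ α → Meets (_< α)
      FIP⇒meets-below = <-induction _ λ α ih → meets (_< α) λ β → ih

      FIP⇒realized : FIP d → ∃[ v ] (v ∈ d × (∀ α → v ∈ A α))
      FIP⇒realized fip =
        let (v , v∈d , h) = meets (λ _ → ⊤) (λ α _ → FIP⇒meets-below α) d (λ _ v∈d → v∈d) fip
        in  v , v∈d , λ α → h α _

-- Reduction of the type to subsets of `d`

mainTheorem3 : (∀ {a} → ExcludedMiddle a) →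
    (∀ {a b} → Extensionality a b) →
    ∀ {ℓ} (𝕍 : Structure ℓ) → IsModelOfZFC⁻ 𝕍 →
    (ω̂ : Structure.Carrier 𝕍) → IsOmega 𝕍 ω̂ → IsNonstandardOmega 𝕍 ω̂ →
    (𝔭 : Cardinal ℓ) → Is𝔭 𝕍 ω̂ 𝔭 →
    (Λ : Cardinal ℓ) → Λ <ᶜ 𝔭 →
    (φ : Cardinal.Carrier Λ → Formula 2) (a : Cardinal.Carrier Λ → Structure.Carrier 𝕍) →
    IsPartialType 𝕍 φ a →
    (o : Cardinal.Carrier Λ) → IsZero Λ o →
    (X̂ : Structure.Carrier 𝕍) → IsFinite 𝕍 X̂ →
    φ o ≡ (zero ∈ᶠ suc zero) → a o ≡ X̂ →
    IsRealized 𝕍 φ a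
mainTheorem3 em ext {ℓ} 𝕍 zfc ω̂ isOmega nonstandard 𝔭 is𝔭 Λ Λ<𝔭 φ a partialType o _ X̂
             (ω′ , isOmega′ , d , d∈ω′ , f , f-bijection) φo≡ ao≡X̂ =
  case Classical.enumerated-or-infinite em (Cardinal.Carrier Λ) of λ where
    (inj₁ (s , complete)) →
      let (c , realizes) = partialType s
      in  c , λ i → All.lookup realizes (complete i)
    (inj₂ fresh) → infinite-case fresh
  where
  open Structure 𝕍 renaming (Carrier to V)
  open Model em 𝕍 zfc
  open Omega em 𝕍 zfc ω̂ isOmega
  open IsBijection f-bijection

  realizes-o : ∀ {c} → Realizes 𝕍 φ a c o → c ∈ X̂
  realizes-o {c} sat =
    subst (c ∈_) ao≡X̂ (subst (λ ψ → Sat 𝕍 ψ (c ∷ a o ∷ [])) φo≡ sat)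

  d∈ω : d ∈ ω̂
  -- The `ω′` witnessing finiteness of `X̂` is contained in every inductive set, in particular in
  -- `ω̂`.
  d∈ω = proj₂ isOmega′ ω̂ (proj₁ isOmega) d d∈ω′

  preimageφ : ExtFormula 3
  preimageφ = ∃ᵉ (v0 ∈ᵉ v3 ∧ᵉ ⟨ v1 , v0 ⟩ᵗ ∈ᵉ v2)

  definable : ∀ i → ∃[ y ] (∀ z → z ∈ y ⇔ (z ∈ X̂ × Realizes 𝕍 φ a z i))
  definable i = IsModelOfZFC⁻.separation zfc (φ i) (a i ∷ []) X̂

  -- The preimage under the bijection `f` of the subset of `X̂` defined by `φ i`.
  A : Cardinal.Carrier Λ → V
  A i = sep preimageφ (f ∷ proj₁ (definable i) ∷ []) d

  fip : (s : List (Cardinal.Carrier Λ)) → ∃[ v ] (v ∈ d × All (λ i → v ∈ A i) s)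
  fip s =
    -- Adding `o` forces the realization into `X̂`, where it has a preimage under `f`.
    let (c , realizes) = partialType (o ∷ s)
        c∈X = realizes-o (All.head realizes)
        (v , (v∈d , vfc) , _) = bijective c c∈X
    in  v , v∈d , All.map
          (λ {i} sat → ∈sep⁺ preimageφ v∈d
            (c , from (proj₂ (definable i) c) (c∈X , sat) , to related⇔ vfc))
          (All.tail realizes)

  -- The empty list already gives an element of `d`; division by `d` requires this.
  ∅∈d : ∅ ∈ d
  ∅∈d = let (v , v∈d , _) = fip [] in ≤-∈-trans d∈ω (∅≤ (∈ω-trans v∈d d∈ω)) v∈d

  infinite-case : _ → IsRealized 𝕍 φ a
  infinite-case fresh = x , λ i →
      let (_ , y , y∈ , vfy) = ∈sep⁻ preimageφ (v∈A i)
          (y∈X , sat) = to (proj₂ (definable i) y) y∈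
      in  subst (λ z → Realizes 𝕍 φ a z i) (sym (unique (y∈X , from related⇔ vfy))) sat
    where
    open Saturation em ext 𝕍 zfc ω̂ isOmega nonstandard 𝔭 is𝔭 Λ Λ<𝔭 fresh

    realized : ∃[ v ] (v ∈ d × (∀ i → v ∈ A i))
    realized = FIP⇒realized d d∈ω ∅∈d A fip

    v : V
    v = proj₁ realized

    v∈A : ∀ i → v ∈ A i
    v∈A = proj₂ (proj₂ realized)

    value : ∃[ x ] ((x ∈ X̂ × Related 𝕍 f v x) × (∀ {y} → y ∈ X̂ × Related 𝕍 f v y → x ≡ y))
    value = functional v (proj₁ (proj₂ realized))

    x : V
    x = proj₁ value

    unique : ∀ {y} → y ∈ X̂ × Related 𝕍 f v y → x ≡ y
    unique = proj₂ (proj₂ value)
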